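{- For each integer $n\ge 0$, let $d_n$ be the smallest positive integer such that $d_n \cdot (1^n + 2^n + \cdots + x^n)$ is a polynomial in $x$ with integer coefficients, let $q_n := d_n/(n+1)$ (an integer), and let $M_n := \frac{n+2}{2}$ if $n$ is even and $M_n := \frac{n+2}{3}$ if $n$ is odd. Then for all $n \ge 0$, $$q_n = \prod_{\substack{p \le M_n \\ s_p(n+1) \ge p}} p,$$ the product running over primes $p$ (an empty product equals $1$). Moreover, the bound $M_n$ is sharp for infinitely many even values of $n$ and for infinitely many odd values of $n$, i.e., there are infinitely many even $n$ and infinitely many odd $n$ such that $M_n$ is a prime dividing $q_n$. In particular, the sequence $(q_n)_{n \ge 0}$ is unbounded.
   Context: Here $1^n+2^n+\cdots+x^n$ denotes the unique polynomial in $\mathbb{Q}[x]$ agreeing with this sum for all positive integers $x$. For a prime $p$ and an integer $x \ge 0$ with base-$p$ expansion $x = \alpha_0 + \alpha_1 p + \cdots + \alpha_r p^r$, $0 \le \alpha_j \le p-1$, the digit sum is $s_p(x) := \alpha_0 + \alpha_1 + \cdots + \alpha_r$. -}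

module Defs where

open import Data.Nat using (ℕ; zero; suc; _+_; _*_; _^_; _≤_; _<_; _≤?_; _≡ᵇ_)
open import Data.Nat.DivMod using (_/_; _%_)
open import Data.Nat.Divisibility using (_∣_)
open import Data.Nat.Primality using (Prime; prime?)
open import Data.Integer as ℤ using (ℤ; +_)
open import Data.List using (List; []; _∷_; upTo; map)
open import Data.Nat.ListAction using (product)
open import Data.Bool using (Bool; true; false; if_then_else_; _∧_)
open import Data.Product using (Σ; ∃; _×_)
open import Relation.Nullary.Decidable using (⌊_⌋)
open import Relation.Binary.PropositionalEquality using (_≡_)

evalℤ : List ℤ → ℤ → ℤ
evalℤ []       x = + 0
evalℤ (c ∷ cs) x = c ℤ.+ x ℤ.* evalℤ cs x

powSum : ℕ → ℕ → ℕ
powSum n zero    = 0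
powSum n (suc x) = powSum n x + suc x ^ n

-- d · (1^n + ... + x^n) is a polynomial in x with integer coefficients:
-- some integer polynomial agrees with it at every positive integer x
-- (hence equals it, by uniqueness of the interpolating polynomial).
IntPolyMultiple : ℕ → ℕ → Set
IntPolyMultiple n d =
  Σ (List ℤ) λ P → ∀ (x : ℕ) → 1 ≤ x → evalℤ P (+ x) ≡ + (d * powSum n x)

IsDenominator : ℕ → ℕ → Set
IsDenominator n d =
  (1 ≤ d) × IntPolyMultiple n d × (∀ d' → 1 ≤ d' → IntPolyMultiple n d' → d ≤ d')

IsQ : ℕ → ℕ → Set
IsQ n q = IsDenominator n (suc n * q)

-- base-p digit sum (fuel-based; fuel x+1 suffices for base ≥ 2)
digitSumAux : ℕ → (k x : ℕ) → ℕ
digitSumAux zero    k x = 0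
digitSumAux (suc f) k x = x % suc (suc k) + digitSumAux f k (x / suc (suc k))

-- s_p(x); meaningful for p ≥ 2 (only used for primes); returns 0 for p < 2
digitSum : ℕ → ℕ → ℕ
digitSum zero          x = 0
digitSum (suc zero)    x = 0
digitSum (suc (suc k)) x = digitSumAux (suc x) k x

belowM : ℕ → ℕ → Bool
belowM n p = if n % 2 ≡ᵇ 0 then ⌊ 2 * p ≤? n + 2 ⌋ else ⌊ 3 * p ≤? n + 2 ⌋

factor : ℕ → ℕ → ℕ
factor n p =
  if ⌊ prime? p ⌋ ∧ belowM n p ∧ ⌊ p ≤? digitSum p (suc n) ⌋ then p else 1

-- ∏_{p prime, p ≤ M_n, s_p(n+1) ≥ p} p   (all such p are < n + 3)
qFormula : ℕ → ℕ
qFormula n = product (map (factor n) (upTo (n + 3)))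

{-# OPTIONS --safe #-}

-- Write S_n(x) = 1^n + ⋯ + x^n and m = n + 1.  Expanding S_m(x + p) in two ways gives
--     Σ_{i<m} C(m,i) p^(m−i) S_i(x) = Σ_{0<j≤m} C(m,j) S_(m−j)(p) x^j,
-- whose top term on the left is p·m·S_n.  By induction p·m·S_n has p-integral
-- coefficients for every prime p, and (p odd or m even) it is congruent modulo p to the
-- right-hand side.  In that case m·S_n is p-integral iff p divides C(m,k) S_k(p) for all k < m.
-- As p ∤ S_k(p) exactly when k ≥ 1 and p − 1 ∣ k, Lucas' theorem turns this into
-- s_p(m) < p.  For p = 2 and odd m > 1, m·S_n fails to be 2-integral because
-- its values at 1 and 3 have different parity.  Finally m divides every d with
-- d·S_n ∈ ℤ[x], because the m-th difference of d·S_n is d·n!, a multiple of m!.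

module Submission where

open import Defs
open import Algebra.Properties.AbelianGroup using (∙-cancelˡ)
open import Data.Bool using (Bool; true; false; if_then_else_; _∧_)
open import Data.Empty using (⊥; ⊥-elim)
open import Data.Integer as ℤ using (ℤ; +_; ∣_∣)
import Data.Integer.Properties as ℤₚ
import Data.Integer.Tactic.RingSolver as ℤ-Solver
open import Data.List using (List; []; _∷_; applyUpTo; map; upTo)
open import Data.List.Membership.Propositional using (_∈_)
open import Data.List.Membership.Propositional.Properties using (∈-map⁺; ∈-upTo⁺)
open import Data.List.Properties using (map-upTo)
open import Data.List.Relation.Unary.All using (All; []; _∷_)
import Data.List.Relation.Unary.All.Properties as All
open import Data.List.Relation.Unary.AllPairs using (AllPairs; []; _∷_)
import Data.List.Relation.Unary.AllPairs.Properties as AllPairs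
open import Data.Nat
open import Data.Nat.Combinatorics hiding (_P_)
open import Data.Nat.Coprimality as Coprimality using (Coprime)
open import Data.Nat.DivMod
open import Data.Nat.Divisibility
open import Data.Nat.GCD using (gcd; gcd[m,n]∣m; gcd[m,n]∣n; gcd[m,n]≡0⇒m≡0; gcd-GCD; module Bézout)
open import Data.Nat.Induction using (<-rec)
open import Data.Nat.ListAction using (product)
open import Data.Nat.ListAction.Properties using (∈⇒∣product)
open import Data.Nat.Primality
open import Data.Nat.Primality.Factorisation using (factorise)
open import Data.Nat.Properties
open import Data.Nat.Tactic.RingSolver using (solve-∀)
open import Data.Product using (Σ; _×_; _,_)
open import Data.Sum using (_⊎_; inj₁; inj₂)
open import Function using (_∘_)
open import Relation.Binary.PropositionalEquality
open import Relation.Nullary using (¬_; Dec; yes; no)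
open import Relation.Nullary.Decidable using (⌊_⌋)

-- The congruence modulo `p` rests on one estimate. Absorption rewrites the summand with `k = m - j`
-- as `p^(j-1)/j` times `C(m,k+1)` times `p(k+1)S_k`. For `j ≥ 2` the factor `p^(j-1)/j` is
-- p-integral, and it is even divisible by `p` unless `p = j = 2`. That one exception sits at
-- `k = m - 2`; for even `m` its binomial coefficient `C(m,m-1) = m` supplies the missing factor 2.
-- This is the origin of the split into "`p` odd or `m` even" and the rest. p-integrality of
-- `p m S_n` also keeps the exponent of each prime in `q_n` at most one. No rational numbers occur:
-- p-integrality is witnessed by an integer multiplier prime to `p`, and the multipliers for the
-- various primes are merged into a global one by gcds. The bound `p ≤ M_n` is derived from
-- `s_p(n+1) ≥ p` by inspecting the quotient of `n+1` by `p`. Its extreme cases `n+1 = (p-1) + p`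
-- and `n+1 = (p-1) + 2p` are the ones that give sharpness.

-- Finite sums, the binomial theorem and translated power sums

∑ : ℕ → (ℕ → ℕ) → ℕ
∑ zero    f = 0
∑ (suc n) f = f 0 + ∑ n (f ∘ suc)

∑-cong : ∀ n {f g} → (∀ i → i < n → f i ≡ g i) → ∑ n f ≡ ∑ n g
∑-cong zero    eq = refl
∑-cong (suc n) eq = cong₂ _+_ (eq 0 z<s) (∑-cong n (λ i i<n → eq (suc i) (s<s i<n)))

∑-last : ∀ n f → ∑ (suc n) f ≡ ∑ n f + f n
∑-last zero    f = +-comm (f 0) 0
∑-last (suc n) f = trans (cong (λ z → f 0 + z) (∑-last n (f ∘ suc))) (sym (+-assoc (f 0) _ _))

∑-+ : ∀ n f g → ∑ n (λ i → f i + g i) ≡ ∑ n f + ∑ n g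
∑-+ zero    f g = refl
∑-+ (suc n) f g = trans (cong (λ z → f 0 + g 0 + z) (∑-+ n (f ∘ suc) (g ∘ suc))) (lemma (f 0) (g 0) _ _)
  where
  lemma : ∀ a b c d → a + b + (c + d) ≡ a + c + (b + d)
  lemma = solve-∀

∑-* : ∀ n c f → ∑ n (λ i → c * f i) ≡ c * ∑ n f
∑-* zero    c f = sym (*-zeroʳ c)
∑-* (suc n) c f = trans (cong (λ z → c * f 0 + z) (∑-* n c (f ∘ suc))) (sym (*-distribˡ-+ c (f 0) _))

∑-zero : ∀ n {f} → (∀ i → i < n → f i ≡ 0) → ∑ n f ≡ 0
∑-zero zero    eq = refl
∑-zero (suc n) eq = cong₂ _+_ (eq 0 z<s) (∑-zero n (λ i i<n → eq (suc i) (s<s i<n)))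

∑-∣ : ∀ d n {f} → (∀ i → i < n → d ∣ f i) → d ∣ ∑ n f
∑-∣ d zero    d∣ = d ∣0
∑-∣ d (suc n) d∣ = ∣m∣n⇒∣m+n (d∣ 0 z<s) (∑-∣ d n (λ i i<n → d∣ (suc i) (s<s i<n)))

binomial : ∀ n x y → (x + y) ^ n ≡ ∑ (suc n) (λ k → (n C k) * (x ^ k * y ^ (n ∸ k)))
binomial zero    x y = refl
binomial (suc n) x y = begin
  (x + y) * (x + y) ^ n
    ≡⟨ cong ((x + y) *_) (binomial n x y) ⟩
  (x + y) * S
    ≡⟨ *-distribʳ-+ S x y ⟩
  x * S + y * S
    ≡⟨ cong₂ _+_ (∑-* (suc n) x t) yS ⟨
  ∑ (suc n) (λ k → x * t k) + (t′ 0 + ∑ n u)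
    ≡⟨ rearrange (∑ (suc n) (λ k → x * t k)) (t′ 0) (∑ n u) ⟩
  t′ 0 + (∑ (suc n) (λ k → x * t k) + (∑ n u + 0))
    ≡⟨ cong (λ z → t′ 0 + (∑ (suc n) (λ k → x * t k) + (∑ n u + z))) un≡0 ⟨
  t′ 0 + (∑ (suc n) (λ k → x * t k) + (∑ n u + u n))
    ≡⟨ cong (λ z → t′ 0 + (∑ (suc n) (λ k → x * t k) + z)) (∑-last n u) ⟨
  t′ 0 + (∑ (suc n) (λ k → x * t k) + ∑ (suc n) u)
    ≡⟨ cong (λ z → t′ 0 + z) (∑-+ (suc n) (λ k → x * t k) u) ⟨
  t′ 0 + ∑ (suc n) (λ k → x * t k + u k)
    ≡⟨ cong (λ z → t′ 0 + z) (∑-cong (suc n) (λ k _ → pascal k)) ⟩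
  ∑ (suc (suc n)) t′ ∎
  where
  open ≡-Reasoning
  t t′ u : ℕ → ℕ
  t k  = (n C k) * (x ^ k * y ^ (n ∸ k))
  t′ k = (suc n C k) * (x ^ k * y ^ (suc n ∸ k))
  u k  = (n C suc k) * (x ^ suc k * y ^ (n ∸ k))
  S = ∑ (suc n) t
  rearrange : ∀ a b c → a + (b + c) ≡ b + (a + (c + 0))
  rearrange = solve-∀
  un≡0 : u n ≡ 0
  un≡0 = cong (_* (x ^ suc n * y ^ (n ∸ n))) (k>n⇒nCk≡0 (n<1+n n))
  pull : ∀ a b c d → a * (b * (c * d)) ≡ c * (a * (b * d))
  pull = solve-∀
  yS : t′ 0 + ∑ n u ≡ y * S
  yS = trans (∑-cong (suc n) {λ k → (n C k) * (x ^ k * y ^ (suc n ∸ k))} (λ k k<1+n →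
         trans (cong (λ e → (n C k) * (x ^ k * y ^ e)) (+-∸-assoc 1 (≤-pred k<1+n)))
               (pull (n C k) (x ^ k) y (y ^ (n ∸ k)))))
       (∑-* (suc n) y t)
  factor-out : ∀ a b x z w → x * (a * (z * w)) + b * (x * z * w) ≡ (a + b) * (x * z * w)
  factor-out = solve-∀
  pascal : ∀ k → x * t k + u k ≡ t′ (suc k)
  pascal k = trans (factor-out (n C k) (n C suc k) x (x ^ k) (y ^ (n ∸ k)))
                   (cong (_* (x ^ suc k * y ^ (n ∸ k))) (nCk+nC[k+1]≡[n+1]C[k+1] n k))

-- Induction on `x`: the new term `(suc x + p)^m`, expanded binomially, increases each `powSum i x`
-- by `suc x ^ i`.
powSum-+ : ∀ m p x →
  powSum m (x + p) ≡ powSum m p + ∑ (suc m) (λ i → (m C i) * (p ^ (m ∸ i) * powSum i x))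
powSum-+ m p zero    = sym (trans (cong (λ z → powSum m p + z) (∑-zero (suc m) λ i _ →
    trans (cong ((m C i) *_) (*-zeroʳ (p ^ (m ∸ i)))) (*-zeroʳ (m C i)))) (+-identityʳ _))
powSum-+ m p (suc x) = begin
  powSum m (x + p) + (suc x + p) ^ m
    ≡⟨ cong₂ _+_ (powSum-+ m p x) (binomial m (suc x) p) ⟩
  powSum m p + ∑ (suc m) f + ∑ (suc m) g
    ≡⟨ +-assoc (powSum m p) _ _ ⟩
  powSum m p + (∑ (suc m) f + ∑ (suc m) g)
    ≡⟨ cong (λ z → powSum m p + z) (∑-+ (suc m) f g) ⟨
  powSum m p + ∑ (suc m) (λ i → f i + g i)
    ≡⟨ cong (λ z → powSum m p + z) (∑-cong (suc m) λ i _ → collect (m C i) (p ^ (m ∸ i)) (powSum i x) (suc x ^ i)) ⟩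
  powSum m p + ∑ (suc m) (λ i → (m C i) * (p ^ (m ∸ i) * powSum i (suc x))) ∎
  where
  open ≡-Reasoning
  f g : ℕ → ℕ
  f i = (m C i) * (p ^ (m ∸ i) * powSum i x)
  g i = (m C i) * (suc x ^ i * p ^ (m ∸ i))
  collect : ∀ a b s z → a * (b * s) + a * (z * b) ≡ a * (b * (s + z))
  collect = solve-∀

-- The same induction run on `p` with `x` fixed, so that the expansion is in powers of `x`.
powSum-+′ : ∀ m p x →
  powSum m (p + x) ≡ powSum m x + ∑ (suc m) (λ j → (m C j) * (x ^ j * powSum (m ∸ j) p))
powSum-+′ m zero    x = sym (trans (cong (λ z → powSum m x + z) (∑-zero (suc m) λ j _ →
    trans (cong ((m C j) *_) (*-zeroʳ (x ^ j))) (*-zeroʳ (m C j)))) (+-identityʳ _))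
powSum-+′ m (suc p) x = begin
  powSum m (p + x) + (suc p + x) ^ m
    ≡⟨ cong₂ _+_ (powSum-+′ m p x) (trans (cong (_^ m) (+-comm (suc p) x)) (binomial m x (suc p))) ⟩
  powSum m x + ∑ (suc m) f + ∑ (suc m) g
    ≡⟨ +-assoc (powSum m x) _ _ ⟩
  powSum m x + (∑ (suc m) f + ∑ (suc m) g)
    ≡⟨ cong (λ z → powSum m x + z) (∑-+ (suc m) f g) ⟨
  powSum m x + ∑ (suc m) (λ j → f j + g j)
    ≡⟨ cong (λ z → powSum m x + z) (∑-cong (suc m) λ j _ → collect (m C j) (x ^ j) (powSum (m ∸ j) p) (suc p ^ (m ∸ j))) ⟩
  powSum m x + ∑ (suc m) (λ j → (m C j) * (x ^ j * powSum (m ∸ j) (suc p))) ∎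
  where
  open ≡-Reasoning
  f g : ℕ → ℕ
  f j = (m C j) * (x ^ j * powSum (m ∸ j) p)
  g j = (m C j) * (x ^ j * suc p ^ (m ∸ j))
  collect : ∀ a b s z → a * (b * s) + a * (b * z) ≡ a * (b * (s + z))
  collect = solve-∀

-- Both sides are S_m(x + p) − S_m(x) − S_m(p), expanded by the binomial
-- theorem once in the powers of p and once in the powers of x.
reciprocity : ∀ m p x →
  ∑ m (λ i → (m C i) * (p ^ (m ∸ i) * powSum i x)) ≡
  ∑ m (λ j → (m C suc j) * (x ^ suc j * powSum (m ∸ suc j) p))
reciprocity m p x = +-cancelˡ-≡ (powSum m p + powSum m x) _ _ (begin
  powSum m p + powSum m x + ∑ m f
    ≡⟨ rearrange (powSum m p) (powSum m x) (∑ m f) ⟩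
  powSum m p + (∑ m f + powSum m x)
    ≡⟨ cong (λ z → powSum m p + (∑ m f + z)) last ⟨
  powSum m p + (∑ m f + f m)
    ≡⟨ cong (λ z → powSum m p + z) (∑-last m f) ⟨
  powSum m p + ∑ (suc m) f
    ≡⟨ powSum-+ m p x ⟨
  powSum m (x + p)
    ≡⟨ cong (powSum m) (+-comm x p) ⟩
  powSum m (p + x)
    ≡⟨ powSum-+′ m p x ⟩
  powSum m x + (1 * (1 * powSum m p) + ∑ m g)
    ≡⟨ rearrange′ (powSum m x) (powSum m p) (∑ m g) ⟩
  powSum m p + powSum m x + ∑ m g ∎)
  where
  open ≡-Reasoning
  f g : ℕ → ℕ
  f i = (m C i) * (p ^ (m ∸ i) * powSum i x)
  g j = (m C suc j) * (x ^ suc j * powSum (m ∸ suc j) p)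
  last : f m ≡ powSum m x
  last = trans (cong₂ (λ c e → c * (p ^ e * powSum m x)) (nCn≡1 m) (n∸n≡0 m))
               (trans (*-identityˡ _) (*-identityˡ _))
  rearrange : ∀ a b c → a + b + c ≡ a + (c + b)
  rearrange = solve-∀
  rearrange′ : ∀ a b c → a + (1 * (1 * b) + c) ≡ b + a + c
  rearrange′ = solve-∀

-- Integer polynomials as coefficient lists

infixl 6 _⊞_
infixl 7 _⊡_

_⊞_ : List ℤ → List ℤ → List ℤ
[]       ⊞ Q        = Q
(a ∷ P)  ⊞ []       = a ∷ P
(a ∷ P)  ⊞ (b ∷ Q)  = (a ℤ.+ b) ∷ (P ⊞ Q)

_⊡_ : ℤ → List ℤ → List ℤ
c ⊡ []      = []
c ⊡ (a ∷ P) = (c ℤ.* a) ∷ (c ⊡ P)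

coeff : List ℤ → ℕ → ℤ
coeff []      j       = + 0
coeff (a ∷ P) zero    = a
coeff (a ∷ P) (suc j) = coeff P j

eval-⊞ : ∀ P Q x → evalℤ (P ⊞ Q) x ≡ evalℤ P x ℤ.+ evalℤ Q x
eval-⊞ []      Q       x = sym (ℤₚ.+-identityˡ _)
eval-⊞ (a ∷ P) []      x = sym (ℤₚ.+-identityʳ _)
eval-⊞ (a ∷ P) (b ∷ Q) x rewrite eval-⊞ P Q x = lemma a b x (evalℤ P x) (evalℤ Q x)
  where
  lemma : ∀ a b x u v → a ℤ.+ b ℤ.+ x ℤ.* (u ℤ.+ v) ≡ a ℤ.+ x ℤ.* u ℤ.+ (b ℤ.+ x ℤ.* v)
  lemma = ℤ-Solver.solve-∀

eval-⊡ : ∀ c P x → evalℤ (c ⊡ P) x ≡ c ℤ.* evalℤ P x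
eval-⊡ c []      x = sym (ℤₚ.*-zeroʳ c)
eval-⊡ c (a ∷ P) x rewrite eval-⊡ c P x = lemma c a x (evalℤ P x)
  where
  lemma : ∀ c a x u → c ℤ.* a ℤ.+ x ℤ.* (c ℤ.* u) ≡ c ℤ.* (a ℤ.+ x ℤ.* u)
  lemma = ℤ-Solver.solve-∀

coeff-⊞ : ∀ P Q j → coeff (P ⊞ Q) j ≡ coeff P j ℤ.+ coeff Q j
coeff-⊞ []      Q       j       = sym (ℤₚ.+-identityˡ _)
coeff-⊞ (a ∷ P) []      j       = sym (ℤₚ.+-identityʳ _)
coeff-⊞ (a ∷ P) (b ∷ Q) zero    = refl
coeff-⊞ (a ∷ P) (b ∷ Q) (suc j) = coeff-⊞ P Q j

coeff-⊡ : ∀ c P j → coeff (c ⊡ P) j ≡ c ℤ.* coeff P j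
coeff-⊡ c []      j       = sym (ℤₚ.*-zeroʳ c)
coeff-⊡ c (a ∷ P) zero    = refl
coeff-⊡ c (a ∷ P) (suc j) = coeff-⊡ c P j

coeff-zero : ∀ P → (∀ x → 1 ≤ x → evalℤ P (+ x) ≡ + 0) → ∀ j → coeff P j ≡ + 0
coeff-zero []      ev j = refl
coeff-zero (a ∷ P) ev j = go j
  where
  -- Evaluating at x = ∣a∣ + 1 shows that x divides a, although x > ∣a∣.
  a≡0 : a ≡ + 0
  a≡0 = ℤₚ.∣i∣≡0⇒i≡0 (∣a∣≡0 ∣ a ∣ (divides ∣ evalℤ P (+ y) ∣ (trans (cong ∣_∣ a≡)
          (trans (ℤₚ.abs-* (ℤ.- evalℤ P (+ y)) (+ y)) (cong (_* y) (ℤₚ.∣-i∣≡∣i∣ (evalℤ P (+ y))))))))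
    where
    y = suc ∣ a ∣
    isolate : ∀ a x u → a ≡ (a ℤ.+ x ℤ.* u) ℤ.+ ℤ.- u ℤ.* x
    isolate = ℤ-Solver.solve-∀
    a≡ : a ≡ ℤ.- evalℤ P (+ y) ℤ.* + y
    a≡ = trans (isolate a (+ y) (evalℤ P (+ y)))
               (trans (cong (ℤ._+ ℤ.- evalℤ P (+ y) ℤ.* + y) (ev y z<s)) (ℤₚ.+-identityˡ _))
    ∣a∣≡0 : ∀ n → suc n ∣ n → n ≡ 0
    ∣a∣≡0 zero    _ = refl
    ∣a∣≡0 (suc n) d = ⊥-elim (<-irrefl refl (∣⇒≤ d))
  tail-zero : ∀ x → 1 ≤ x → evalℤ P (+ x) ≡ + 0
  tail-zero (suc x) 1≤x with ℤₚ.i*j≡0⇒i≡0∨j≡0 (+ suc x) {evalℤ P (+ suc x)}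
    (trans (sym (ℤₚ.+-identityˡ _)) (trans (cong (ℤ._+ (+ suc x ℤ.* evalℤ P (+ suc x))) (sym a≡0)) (ev (suc x) 1≤x)))
  ... | inj₂ eq = eq
  go : ∀ j → coeff (a ∷ P) j ≡ + 0
  go zero    = a≡0
  go (suc j) = coeff-zero P tail-zero j

-- Polynomials enter only through their values at positive integers; this lets divisibility by `p`
-- pass from value functions to coefficients.
coeff-unique : ∀ P Q → (∀ x → 1 ≤ x → evalℤ P (+ x) ≡ evalℤ Q (+ x)) → ∀ j → coeff P j ≡ coeff Q j
coeff-unique P Q ev j = ℤₚ.i-j≡0⇒i≡j _ _ (begin
  coeff P j ℤ.- coeff Q j
    ≡⟨ cong (λ z → coeff P j ℤ.+ z) (trans (coeff-⊡ ℤ.-1ℤ Q j) (ℤₚ.-1*i≡-i (coeff Q j))) ⟨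
  coeff P j ℤ.+ coeff (ℤ.-1ℤ ⊡ Q) j
    ≡⟨ coeff-⊞ P (ℤ.-1ℤ ⊡ Q) j ⟨
  coeff (P ⊞ ℤ.-1ℤ ⊡ Q) j
    ≡⟨ coeff-zero (P ⊞ ℤ.-1ℤ ⊡ Q) vanish j ⟩
  + 0 ∎)
  where
  open ≡-Reasoning
  vanish : ∀ x → 1 ≤ x → evalℤ (P ⊞ ℤ.-1ℤ ⊡ Q) (+ x) ≡ + 0
  vanish x 1≤x = trans (eval-⊞ P (ℤ.-1ℤ ⊡ Q) (+ x))
    (trans (cong₂ ℤ._+_ (ev x 1≤x) (trans (eval-⊡ ℤ.-1ℤ Q (+ x)) (ℤₚ.-1*i≡-i (evalℤ Q (+ x)))))
      (ℤₚ.+-inverseʳ (evalℤ Q (+ x))))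

fromCoeffs : ℕ → (ℕ → ℕ) → List ℤ
fromCoeffs n g = applyUpTo (λ j → + g j) n

coeff-fromCoeffs : ∀ n g j → j < n → coeff (fromCoeffs n g) j ≡ + g j
coeff-fromCoeffs (suc n) g zero    j<n = refl
coeff-fromCoeffs (suc n) g (suc j) j<n = coeff-fromCoeffs n (g ∘ suc) j (≤-pred j<n)

eval-fromCoeffs : ∀ n g x → evalℤ (fromCoeffs n g) (+ x) ≡ + ∑ n (λ j → g j * x ^ j)
eval-fromCoeffs zero    g x = refl
eval-fromCoeffs (suc n) g x = begin
  + g 0 ℤ.+ + x ℤ.* evalℤ (fromCoeffs n (g ∘ suc)) (+ x)
    ≡⟨ cong (λ z → + g 0 ℤ.+ + x ℤ.* z) (eval-fromCoeffs n (g ∘ suc) x) ⟩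
  + g 0 ℤ.+ + x ℤ.* + ∑ n (λ j → g (suc j) * x ^ j)
    ≡⟨ cong (λ z → + g 0 ℤ.+ z) (ℤₚ.pos-* x _) ⟨
  + (g 0 + x * ∑ n (λ j → g (suc j) * x ^ j))
    ≡⟨ cong +_ (cong₂ _+_ (*-identityʳ (g 0)) (trans (∑-cong n λ j _ → swap (g (suc j)) x (x ^ j)) (∑-* n x _))) ⟨
  + (g 0 * 1 + ∑ n (λ j → g (suc j) * (x * x ^ j))) ∎
  where
  open ≡-Reasoning
  swap : ∀ a b c → a * (b * c) ≡ b * (a * c)
  swap = solve-∀

-- Absorption identities and the reciprocity polynomial

[1+k]*[1+n]C[1+k]≡[1+n]*nCk : ∀ n k → suc k * (suc n C suc k) ≡ suc n * (n C k)
[1+k]*[1+n]C[1+k]≡[1+n]*nCk n       zero    = trans (*-identityˡ (suc n C 1)) (trans (nC1≡n (suc n)) (sym (*-identityʳ (suc n))))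
[1+k]*[1+n]C[1+k]≡[1+n]*nCk zero    (suc k) = trans (cong (suc (suc k) *_) (k>n⇒nCk≡0 {1} {suc (suc k)} (s<s z<s))) (*-zeroʳ (suc (suc k)))
[1+k]*[1+n]C[1+k]≡[1+n]*nCk (suc n) (suc k) = begin
  suc (suc k) * (suc (suc n) C suc (suc k))
    ≡⟨ cong (suc (suc k) *_) (nCk+nC[k+1]≡[n+1]C[k+1] (suc n) (suc k)) ⟨
  suc (suc k) * (a + b)
    ≡⟨ split (suc k) a b ⟩
  a + (suc k * a + suc (suc k) * b)
    ≡⟨ cong₂ (λ y z → a + (y + z)) ([1+k]*[1+n]C[1+k]≡[1+n]*nCk n k) ([1+k]*[1+n]C[1+k]≡[1+n]*nCk n (suc k)) ⟩
  a + (suc n * (n C k) + suc n * (n C suc k))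
    ≡⟨ cong (λ z → a + z) (*-distribˡ-+ (suc n) (n C k) (n C suc k)) ⟨
  a + suc n * ((n C k) + (n C suc k))
    ≡⟨ cong (λ z → a + suc n * z) (nCk+nC[k+1]≡[n+1]C[k+1] n k) ⟩
  a + suc n * a ∎
  where
  open ≡-Reasoning
  a = suc n C suc k
  b = suc n C suc (suc k)
  split : ∀ k a b → suc k * (a + b) ≡ a + (k * a + suc k * b)
  split = solve-∀

-- Creates the factor `suc k` beside `powSum k x`, at the price of a denominator `n ∸ k`;
-- `remainder-term` needs exactly this trade.
[n∸k]*nCk≡[1+k]*nC[1+k] : ∀ {n k} → k ≤ n → (n ∸ k) * (n C k) ≡ suc k * (n C suc k)
[n∸k]*nCk≡[1+k]*nC[1+k] {n} {k} k≤n = sym (+-cancelˡ-≡ (suc k * (n C k)) _ _ (begin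
  suc k * (n C k) + suc k * (n C suc k)
    ≡⟨ *-distribˡ-+ (suc k) (n C k) (n C suc k) ⟨
  suc k * ((n C k) + (n C suc k))
    ≡⟨ cong (suc k *_) (nCk+nC[k+1]≡[n+1]C[k+1] n k) ⟩
  suc k * (suc n C suc k)
    ≡⟨ [1+k]*[1+n]C[1+k]≡[1+n]*nCk n k ⟩
  suc n * (n C k)
    ≡⟨ cong (λ z → suc z * (n C k)) (m+[n∸m]≡n k≤n) ⟨
  suc (k + (n ∸ k)) * (n C k)
    ≡⟨ *-distribʳ-+ (n C k) (suc k) (n ∸ k) ⟩
  suc k * (n C k) + (n ∸ k) * (n C k) ∎))
  where open ≡-Reasoning

[1+n]Cn≡1+n : ∀ n → suc n C n ≡ suc n
[1+n]Cn≡1+n n = trans (nCk≡nC[n∸k] (n≤1+n n)) (trans (cong (suc n C_) (m+n∸n≡m 1 n)) (nC1≡n (suc n)))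

-- The right-hand side of `reciprocity` as a polynomial in `x`, indexed by exponent; it has no
-- constant term.
reciprocityCoeff : ℕ → ℕ → ℕ → ℕ
reciprocityCoeff m p zero    = 0
reciprocityCoeff m p (suc j) = (m C suc j) * powSum (m ∸ suc j) p

eval-reciprocity : ∀ m p x → evalℤ (fromCoeffs (suc m) (reciprocityCoeff m p)) (+ x) ≡
                   + ∑ m (λ i → (m C i) * (p ^ (m ∸ i) * powSum i x))
eval-reciprocity m p x = trans (eval-fromCoeffs (suc m) (reciprocityCoeff m p) x) (cong +_
  (trans (∑-cong m λ j _ → comm (m C suc j) (powSum (m ∸ suc j) p) (x ^ suc j)) (sym (reciprocity m p x))))
  where
  comm : ∀ a b c → a * b * c ≡ a * (c * b)
  comm = solve-∀

-- Polynomials over the integers localised at p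

module _ {p : ℕ} (p-prime : Prime p) where

  private instance
    p≢0 : NonZero p
    p≢0 = prime⇒nonZero p-prime

  1<p : 1 < p
  1<p = nonTrivial⇒n>1 p {{prime⇒nonTrivial p-prime}}

  p∤1 : ¬ p ∣ 1
  p∤1 p∣1 = <⇒≱ 1<p (∣⇒≤ p∣1)

  p∤* : ∀ {a b} → ¬ p ∣ a → ¬ p ∣ b → ¬ p ∣ a * b
  p∤* {a} {b} p∤a p∤b p∣ab with euclidsLemma a b p-prime p∣ab
  ... | inj₁ p∣a = p∤a p∣a
  ... | inj₂ p∣b = p∤b p∣b

  -- f is c times a polynomial over ℤ localised at p; N clears its denominators.
  record LocPoly (c : ℕ) (f : ℕ → ℕ) : Set where
    constructor locPoly
    field
      N   : ℕ
      p∤N : ¬ p ∣ N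
      P   : List ℤ
      ev  : ∀ x → 1 ≤ x → + c ℤ.* evalℤ P (+ x) ≡ + (N * f x)

  LocPoly-cong : ∀ {c f g} → (∀ x → f x ≡ g x) → LocPoly c f → LocPoly c g
  LocPoly-cong f≗g (locPoly N p∤N P ev) = locPoly N p∤N P λ x 1≤x → trans (ev x 1≤x) (cong (λ z → + (N * z)) (f≗g x))

  private
    eval-lin : ∀ a b P Q x → evalℤ (a ⊡ P ⊞ b ⊡ Q) x ≡ a ℤ.* evalℤ P x ℤ.+ b ℤ.* evalℤ Q x
    eval-lin a b P Q x = trans (eval-⊞ (a ⊡ P) (b ⊡ Q) x) (cong₂ ℤ._+_ (eval-⊡ a P x) (eval-⊡ b Q x))

    lin : ∀ c a b u v → c ℤ.* (a ℤ.* u ℤ.+ b ℤ.* v) ≡ a ℤ.* (c ℤ.* u) ℤ.+ b ℤ.* (c ℤ.* v)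
    lin = ℤ-Solver.solve-∀

  LocPoly-+ : ∀ {c f g} → LocPoly c f → LocPoly c g → LocPoly c (λ x → f x + g x)
  LocPoly-+ {c} {f} {g} (locPoly N p∤N P evP) (locPoly M p∤M Q evQ) =
    locPoly (N * M) (p∤* p∤N p∤M) (+ M ⊡ P ⊞ + N ⊡ Q) λ x 1≤x → begin
      + c ℤ.* evalℤ (+ M ⊡ P ⊞ + N ⊡ Q) (+ x)
        ≡⟨ trans (cong (+ c ℤ.*_) (eval-lin (+ M) (+ N) P Q (+ x))) (lin (+ c) (+ M) (+ N) _ _) ⟩
      + M ℤ.* (+ c ℤ.* evalℤ P (+ x)) ℤ.+ + N ℤ.* (+ c ℤ.* evalℤ Q (+ x))
        ≡⟨ cong₂ (λ y z → + M ℤ.* y ℤ.+ + N ℤ.* z) (evP x 1≤x) (evQ x 1≤x) ⟩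
      + M ℤ.* + (N * f x) ℤ.+ + N ℤ.* + (M * g x)
        ≡⟨ cong₂ ℤ._+_ (ℤₚ.pos-* M _) (ℤₚ.pos-* N _) ⟨
      + (M * (N * f x) + N * (M * g x))
        ≡⟨ cong +_ (collect M N (f x) (g x)) ⟩
      + (N * M * (f x + g x)) ∎
    where
    open ≡-Reasoning
    collect : ∀ m n a b → m * (n * a) + n * (m * b) ≡ n * m * (a + b)
    collect = solve-∀

  -- Value functions are natural-valued, so a difference is expressed by cancelling a summand.
  LocPoly-∸ : ∀ {c f g} → LocPoly c (λ x → f x + g x) → LocPoly c f → LocPoly c g
  LocPoly-∸ {c} {f} {g} (locPoly N p∤N P evP) (locPoly M p∤M Q evQ) =
    locPoly (N * M) (p∤* p∤N p∤M) (+ M ⊡ P ⊞ (ℤ.- + N) ⊡ Q) λ x 1≤x → begin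
      + c ℤ.* evalℤ (+ M ⊡ P ⊞ (ℤ.- + N) ⊡ Q) (+ x)
        ≡⟨ trans (cong (+ c ℤ.*_) (eval-lin (+ M) (ℤ.- + N) P Q (+ x))) (lin (+ c) (+ M) (ℤ.- + N) _ _) ⟩
      + M ℤ.* (+ c ℤ.* evalℤ P (+ x)) ℤ.+ (ℤ.- + N) ℤ.* (+ c ℤ.* evalℤ Q (+ x))
        ≡⟨ cong₂ (λ y z → + M ℤ.* y ℤ.+ (ℤ.- + N) ℤ.* z) (evP x 1≤x) (evQ x 1≤x) ⟩
      + M ℤ.* + (N * (f x + g x)) ℤ.+ (ℤ.- + N) ℤ.* + (M * f x)
        ≡⟨ cong₂ (λ y z → + M ℤ.* y ℤ.+ (ℤ.- + N) ℤ.* z) (ℤₚ.pos-* N (f x + g x)) (ℤₚ.pos-* M (f x)) ⟩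
      + M ℤ.* (+ N ℤ.* (+ f x ℤ.+ + g x)) ℤ.+ (ℤ.- + N) ℤ.* (+ M ℤ.* + f x)
        ≡⟨ collect (+ M) (+ N) (+ f x) (+ g x) ⟩
      + N ℤ.* + M ℤ.* + g x
        ≡⟨ trans (ℤₚ.pos-* (N * M) (g x)) (cong (ℤ._* + g x) (ℤₚ.pos-* N M)) ⟨
      + (N * M * g x) ∎
    where
    open ≡-Reasoning
    collect : ∀ m n a b → m ℤ.* (n ℤ.* (a ℤ.+ b)) ℤ.+ (ℤ.- n) ℤ.* (m ℤ.* a) ≡ n ℤ.* m ℤ.* b
    collect = ℤ-Solver.solve-∀

  LocPoly-* : ∀ {c f} k d → LocPoly c f → LocPoly (d * c) (λ x → d * (k * f x))
  LocPoly-* {c} {f} k d (locPoly N p∤N P ev) = locPoly N p∤N (+ k ⊡ P) λ x 1≤x → begin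
    + (d * c) ℤ.* evalℤ (+ k ⊡ P) (+ x)
      ≡⟨ cong₂ ℤ._*_ (ℤₚ.pos-* d c) (eval-⊡ (+ k) P (+ x)) ⟩
    + d ℤ.* + c ℤ.* (+ k ℤ.* evalℤ P (+ x))
      ≡⟨ rearrange (+ d) (+ c) (+ k) (evalℤ P (+ x)) ⟩
    + d ℤ.* + k ℤ.* (+ c ℤ.* evalℤ P (+ x))
      ≡⟨ cong₂ ℤ._*_ (ℤₚ.pos-* d k) (sym (ev x 1≤x)) ⟨
    + (d * k) ℤ.* + (N * f x)
      ≡⟨ ℤₚ.pos-* (d * k) (N * f x) ⟨
    + (d * k * (N * f x))
      ≡⟨ cong +_ (rearrange′ d k N (f x)) ⟩
    + (N * (d * (k * f x))) ∎
    where
    open ≡-Reasoning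
    rearrange : ∀ d c k u → d ℤ.* c ℤ.* (k ℤ.* u) ≡ d ℤ.* k ℤ.* (c ℤ.* u)
    rearrange = ℤ-Solver.solve-∀
    rearrange′ : ∀ d k n u → d * k * (n * u) ≡ n * (d * (k * u))
    rearrange′ = solve-∀

  LocPoly-scale : ∀ {c f} k → LocPoly c f → LocPoly c (λ x → k * f x)
  LocPoly-scale {c} {f} k f-poly = subst (λ z → LocPoly z (λ x → k * f x)) (*-identityˡ c)
    (LocPoly-cong (λ x → *-identityˡ (k * f x)) (LocPoly-* k 1 f-poly))

  LocPoly-p* : ∀ {f} → LocPoly 1 f → LocPoly p (λ x → p * f x)
  LocPoly-p* {f} f-poly = subst (λ z → LocPoly z (λ x → p * f x)) (*-identityʳ p)
    (LocPoly-cong (λ x → cong (p *_) (*-identityˡ (f x))) (LocPoly-* 1 p f-poly))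

  LocPoly-p*⁻ : ∀ {f} → LocPoly p (λ x → p * f x) → LocPoly 1 f
  LocPoly-p*⁻ {f} (locPoly N p∤N P ev) = locPoly N p∤N P λ x 1≤x →
    trans (ℤₚ.*-identityˡ _) (ℤₚ.*-cancelˡ-≡ (+ p) _ _ (trans (ev x 1≤x) (trans (cong +_ (comm N p (f x))) (ℤₚ.pos-* p _))))
    where
    comm : ∀ n p u → n * (p * u) ≡ p * (n * u)
    comm = solve-∀

  -- Division by a p-adic unit: `u` is absorbed into the multiplier `N`.
  LocPoly-unscale : ∀ {c f} u → ¬ p ∣ u → LocPoly c (λ x → u * f x) → LocPoly c f
  LocPoly-unscale {c} {f} u p∤u (locPoly N p∤N P ev) = locPoly (N * u) (p∤* p∤N p∤u) P λ x 1≤x →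
    trans (ev x 1≤x) (cong +_ (sym (*-assoc N u (f x))))

  LocPoly-∑ : ∀ {c} n {f : ℕ → ℕ → ℕ} → (∀ k → k < n → LocPoly c (f k)) → LocPoly c (λ x → ∑ n (λ k → f k x))
  LocPoly-∑ {c} zero    f-poly = locPoly 1 p∤1 [] λ x _ → ℤₚ.*-zeroʳ (+ c)
  LocPoly-∑     (suc n) f-poly = LocPoly-+ (f-poly 0 z<s) (LocPoly-∑ n (λ k k<n → f-poly (suc k) (s<s k<n)))

  -- In fractions this is `p^(j-1)/j = p^e/u`: the power outgrows the p-part of `j`, with a factor
  -- `p` to spare except for `2/2`. The induction strips one factor `p` from `j` at a time.
  p-part : ∀ j → 2 ≤ j → Σ ℕ λ u → Σ ℕ λ e → ¬ p ∣ u × u * p ^ j ≡ j * p ^ suc e × (1 ≤ e ⊎ (p ≡ 2 × j ≡ 2))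
  p-part = <-rec _ step
    where
    step : ∀ j → (∀ {i} → i < j → 2 ≤ i → _) → 2 ≤ j → _
    step (suc zero) rec (s≤s ())
    step j@(suc (suc k)) rec 2≤j with p ∣? j
    ... | no  p∤j = j , suc k , p∤j , refl , inj₁ z<s
    ... | yes (divides 1 j≡p) = 1 , k , p∤1 , eq , e≥1 k j≡p′
      where
      j≡p′ : j ≡ p
      j≡p′ = trans j≡p (*-identityˡ p)
      eq : 1 * p ^ j ≡ j * p ^ suc k
      eq = trans (*-identityˡ (p ^ j)) (cong (_* p ^ suc k) (sym j≡p′))
      e≥1 : ∀ k → suc (suc k) ≡ p → 1 ≤ k ⊎ (p ≡ 2 × suc (suc k) ≡ 2)
      e≥1 zero    eq = inj₂ (sym eq , refl)
      e≥1 (suc k) eq = inj₁ z<s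
    -- With `p = 2 + r`, passing from `i` to `j = i * p` adds `i(p-1)` factors `p`, one of which
    -- turns `i` into `j`. The gain in `e` is therefore `i(p-1) - 1 = suc i″ + r * i`, which is
    -- positive.
    ... | yes (divides i@(suc (suc i″)) j≡ip)
      with r , p≡2+r ← m≤n⇒∃[o]m+o≡n 1<p
      with u , e , p∤u , eq , _ ← rec (subst (i <_) (sym j≡ip) (m<m*n i p 1<p)) (s≤s (s≤s z≤n))
      = u , e + (suc i″ + r * i) , p∤u , lemma , inj₁ (≤-trans (s≤s z≤n) (m≤n+m _ e))
      where
      open ≡-Reasoning
      exponent : j ≡ i + suc (suc i″ + r * i)
      exponent = trans j≡ip (trans (cong (i *_) (sym p≡2+r)) (expand i″ r))
        where
        expand : ∀ i″ r → suc (suc i″) * suc (suc r) ≡ suc (suc i″) + suc (suc i″ + r * suc (suc i″))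
        expand = solve-∀
      rearrange : ∀ i a b p → i * (p * a) * (p * b) ≡ i * p * (p * (a * b))
      rearrange = solve-∀
      lemma : u * p ^ j ≡ j * p ^ suc (e + (suc i″ + r * i))
      lemma = begin
        u * p ^ j                                          ≡⟨ cong (λ z → u * p ^ z) exponent ⟩
        u * p ^ (i + suc (suc i″ + r * i))                 ≡⟨ cong (u *_) (^-distribˡ-+-* p i _) ⟩
        u * (p ^ i * p ^ suc (suc i″ + r * i))             ≡⟨ *-assoc u _ _ ⟨
        u * p ^ i * p ^ suc (suc i″ + r * i)               ≡⟨ cong (_* p ^ suc (suc i″ + r * i)) eq ⟩
        i * (p * p ^ e) * (p * p ^ (suc i″ + r * i))       ≡⟨ rearrange i (p ^ e) (p ^ (suc i″ + r * i)) p ⟩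
        i * p * (p * (p ^ e * p ^ (suc i″ + r * i)))       ≡⟨ cong₂ (λ y z → y * (p * z)) j≡ip (^-distribˡ-+-* p e _) ⟨
        j * p ^ suc (e + (suc i″ + r * i)) ∎

  -- The left-hand side of `reciprocity` at exponent `suc i` without the summand `k = i`, the one
  -- that carries `powSum i`.
  remainder : ℕ → ℕ → ℕ
  remainder i x = ∑ i (λ k → (suc i C k) * (p ^ (suc i ∸ k) * powSum k x))

  remainder-+ : ∀ i x → ∑ (suc i) (λ k → (suc i C k) * (p ^ (suc i ∸ k) * powSum k x)) ≡
                        remainder i x + p * (suc i * powSum i x)
  remainder-+ i x = trans (∑-last i _) (cong (λ z → remainder i x + z)
    (trans (cong₂ (λ c e → c * (p ^ e * powSum i x)) ([1+n]Cn≡1+n i) (m+n∸n≡m 1 i))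
           (rearrange (suc i) p (powSum i x))))
    where
    rearrange : ∀ a p s → a * (p * 1 * s) ≡ p * (a * s)
    rearrange = solve-∀

  -- Absorption replaces `C(i+1,k)` by `(k+1) C(i+1,k+1) / j` with `j = i + 1 - k`, and `p-part`
  -- evaluates `p^j / j`. So each summand is a p-integral multiple of `p(k+1)S_k`, with a spare
  -- factor `p` when `1 ≤ e`.
  remainder-term : ∀ i k → k < i → Σ ℕ λ u → Σ ℕ λ e → ¬ p ∣ u ×
    (∀ x → p ^ e * ((suc i C suc k) * (p * (suc k * powSum k x))) ≡ u * ((suc i C k) * (p ^ (suc i ∸ k) * powSum k x))) ×
    (1 ≤ e ⊎ (p ≡ 2 × suc i ∸ k ≡ 2))
  remainder-term i k k<i with p-part (suc i ∸ k) (subst (2 ≤_) (sym (+-∸-assoc 1 (<⇒≤ k<i))) (s≤s (m<n⇒0<n∸m k<i)))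
  ... | u , e , p∤u , eq , e≥1 = u , e , p∤u , scaled , e≥1
    where
    open ≡-Reasoning
    j = suc i ∸ k
    r₁ : ∀ a b p k s → a * (b * (p * (k * s))) ≡ k * b * (p * a) * s
    r₁ = solve-∀
    r₂ : ∀ j c a s → j * c * a * s ≡ j * a * c * s
    r₂ = solve-∀
    r₃ : ∀ u a c s → u * a * c * s ≡ u * (c * (a * s))
    r₃ = solve-∀
    scaled : ∀ x → p ^ e * ((suc i C suc k) * (p * (suc k * powSum k x))) ≡ u * ((suc i C k) * (p ^ j * powSum k x))
    scaled x = begin
      p ^ e * ((suc i C suc k) * (p * (suc k * powSum k x)))
        ≡⟨ r₁ (p ^ e) (suc i C suc k) p (suc k) (powSum k x) ⟩
      suc k * (suc i C suc k) * p ^ suc e * powSum k x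
        ≡⟨ cong (λ z → z * p ^ suc e * powSum k x) ([n∸k]*nCk≡[1+k]*nC[1+k] (≤-trans (<⇒≤ k<i) (n≤1+n i))) ⟨
      j * (suc i C k) * p ^ suc e * powSum k x
        ≡⟨ r₂ j (suc i C k) (p ^ suc e) (powSum k x) ⟩
      j * p ^ suc e * (suc i C k) * powSum k x
        ≡⟨ cong (λ z → z * (suc i C k) * powSum k x) eq ⟨
      u * p ^ j * (suc i C k) * powSum k x
        ≡⟨ r₃ u (p ^ j) (suc i C k) (powSum k x) ⟩
      u * ((suc i C k) * (p ^ j * powSum k x)) ∎

  reciprocity-LocPoly : ∀ m → LocPoly 1 (λ x → ∑ m (λ k → (m C k) * (p ^ (m ∸ k) * powSum k x)))
  reciprocity-LocPoly m = locPoly 1 p∤1 (fromCoeffs (suc m) (reciprocityCoeff m p)) λ x _ →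
    trans (ℤₚ.*-identityˡ _) (trans (eval-reciprocity m p x) (cong +_ (sym (*-identityˡ _))))

  -- Strong induction: this function is the integral reciprocity polynomial minus `remainder i`,
  -- whose summands are p-integral multiples of the earlier cases.
  p[1+i]S-LocPoly : ∀ i → LocPoly 1 (λ x → p * (suc i * powSum i x))
  p[1+i]S-LocPoly = <-rec _ λ i rec →
    LocPoly-∸ (LocPoly-cong (remainder-+ i) (reciprocity-LocPoly (suc i))) (LocPoly-∑ i λ k k<i → term i k k<i (rec k<i))
    where
    term : ∀ i k → k < i → LocPoly 1 (λ x → p * (suc k * powSum k x)) →
           LocPoly 1 (λ x → (suc i C k) * (p ^ (suc i ∸ k) * powSum k x))
    term i k k<i F-poly with remainder-term i k k<i
    ... | u , e , p∤u , scaled , _ =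
      LocPoly-unscale u p∤u (LocPoly-cong scaled (LocPoly-scale (p ^ e) (LocPoly-scale (suc i C suc k) F-poly)))

  -- The index `p` in `LocPoly p` says that the remainder vanishes modulo `p`. The spare factor from
  -- `remainder-term` gives this for every summand but the one with `p = 2`, `k = i - 1`.
  remainder-LocPoly : ∀ i → (p ≡ 2 → i ≡ 0 ⊎ 2 ∣ suc i) → LocPoly p (remainder i)
  remainder-LocPoly i 2∣1+i = LocPoly-∑ i term
    where
    term : ∀ k → k < i → LocPoly p (λ x → (suc i C k) * (p ^ (suc i ∸ k) * powSum k x))
    term k k<i with remainder-term i k k<i
    ... | u , suc e , p∤u , scaled , _ = LocPoly-unscale u p∤u (LocPoly-cong
            (λ x → trans (sym (*-assoc p (p ^ e) _)) (scaled x))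
            (LocPoly-p* (LocPoly-scale (p ^ e) (LocPoly-scale (suc i C suc k) (p[1+i]S-LocPoly k)))))
    ... | u , zero , p∤u , scaled , inj₂ (p≡2 , 1+i∸k≡2) with 2∣1+i p≡2
    ...   | inj₁ i≡0 = ⊥-elim (n≮0 (subst (k <_) i≡0 k<i))
    -- No factor 2 is left over from the power, but `C(i+1,k+1) = C(i+1,i) = i + 1 = 2h` provides
    -- one.
    ...   | inj₂ (divides h 1+i≡h*2) = LocPoly-unscale u p∤u (LocPoly-cong (λ x → trans (even x) (scaled x))
            (LocPoly-p* (LocPoly-scale h (p[1+i]S-LocPoly k))))
      where
      i≡1+k : i ≡ suc k
      i≡1+k = suc-injective (trans (sym (m+[n∸m]≡n (≤-trans (<⇒≤ k<i) (n≤1+n i)))) (trans (cong (λ z → k + z) 1+i∸k≡2) (+-comm k 2)))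
      C≡hp : suc i C suc k ≡ h * p
      C≡hp = trans (cong (suc i C_) (sym i≡1+k)) (trans ([1+n]Cn≡1+n i) (trans 1+i≡h*2 (cong (h *_) (sym p≡2))))
      rearrange : ∀ p h y → p * (h * y) ≡ 1 * (h * p * y)
      rearrange = solve-∀
      even : ∀ x → p * (h * (p * (suc k * powSum k x))) ≡ 1 * ((suc i C suc k) * (p * (suc k * powSum k x)))
      even x = trans (rearrange p h _) (cong (λ z → 1 * (z * (p * (suc k * powSum k x)))) (sym C≡hp))

  -- Uniqueness of coefficients gives `p * coeff P j = N * g j`, and `p` does not divide `N`.
  LocPoly⇒p∣coeff : ∀ n (g : ℕ → ℕ) → LocPoly p (λ x → ∑ n (λ j → g j * x ^ j)) → ∀ j → j < n → p ∣ g j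
  LocPoly⇒p∣coeff n g (locPoly N p∤N P ev) j j<n with euclidsLemma N (g j) p-prime p∣Ng
    where
    open ≡-Reasoning
    evs : ∀ x → 1 ≤ x → evalℤ (+ p ⊡ P) (+ x) ≡ evalℤ (+ N ⊡ fromCoeffs n g) (+ x)
    evs x 1≤x = begin
      evalℤ (+ p ⊡ P) (+ x)                      ≡⟨ eval-⊡ (+ p) P (+ x) ⟩
      + p ℤ.* evalℤ P (+ x)                      ≡⟨ ev x 1≤x ⟩
      + (N * ∑ n (λ j → g j * x ^ j))            ≡⟨ ℤₚ.pos-* N _ ⟩
      + N ℤ.* + ∑ n (λ j → g j * x ^ j)          ≡⟨ cong (+ N ℤ.*_) (eval-fromCoeffs n g x) ⟨
      + N ℤ.* evalℤ (fromCoeffs n g) (+ x)       ≡⟨ eval-⊡ (+ N) (fromCoeffs n g) (+ x) ⟨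
      evalℤ (+ N ⊡ fromCoeffs n g) (+ x)         ∎
    coeffs : + p ℤ.* coeff P j ≡ + (N * g j)
    coeffs = begin
      + p ℤ.* coeff P j                  ≡⟨ coeff-⊡ (+ p) P j ⟨
      coeff (+ p ⊡ P) j                  ≡⟨ coeff-unique (+ p ⊡ P) (+ N ⊡ fromCoeffs n g) evs j ⟩
      coeff (+ N ⊡ fromCoeffs n g) j     ≡⟨ coeff-⊡ (+ N) (fromCoeffs n g) j ⟩
      + N ℤ.* coeff (fromCoeffs n g) j   ≡⟨ cong (+ N ℤ.*_) (coeff-fromCoeffs n g j j<n) ⟩
      + N ℤ.* + g j                      ≡⟨ ℤₚ.pos-* N (g j) ⟨
      + (N * g j)                        ∎
    p∣Ng : p ∣ N * g j
    p∣Ng = divides ∣ coeff P j ∣ (trans (sym (cong ∣_∣ coeffs)) (trans (ℤₚ.abs-* (+ p) (coeff P j)) (*-comm p _)))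
  ... | inj₁ p∣N  = ⊥-elim (p∤N p∣N)
  ... | inj₂ p∣gj = p∣gj

  p∣coeff⇒LocPoly : ∀ n (g : ℕ → ℕ) → (∀ j → j < n → p ∣ g j) → LocPoly p (λ x → ∑ n (λ j → g j * x ^ j))
  p∣coeff⇒LocPoly n g p∣g = locPoly 1 p∤1 (fromCoeffs n (λ j → g j / p)) λ x _ → begin
    + p ℤ.* evalℤ (fromCoeffs n (λ j → g j / p)) (+ x)
      ≡⟨ cong (+ p ℤ.*_) (eval-fromCoeffs n (λ j → g j / p) x) ⟩
    + p ℤ.* + ∑ n (λ j → g j / p * x ^ j)
      ≡⟨ ℤₚ.pos-* p _ ⟨
    + (p * ∑ n (λ j → g j / p * x ^ j))
      ≡⟨ cong +_ (∑-* n p _) ⟨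
    + ∑ n (λ j → p * (g j / p * x ^ j))
      ≡⟨ cong +_ (∑-cong n λ j j<n → trans (sym (*-assoc p _ _)) (cong (_* x ^ j) (m*[n/m]≡n (p∣g j j<n)))) ⟩
    + ∑ n (λ j → g j * x ^ j)
      ≡⟨ cong +_ (*-identityˡ _) ⟨
    + (1 * ∑ n (λ j → g j * x ^ j)) ∎
    where open ≡-Reasoning

  reciprocity-coeffs : ∀ i x → ∑ (suc (suc i)) (λ j → reciprocityCoeff (suc i) p j * x ^ j) ≡
                               remainder i x + p * (suc i * powSum i x)
  reciprocity-coeffs i x = trans (ℤₚ.+-injective (trans (sym (eval-fromCoeffs (suc (suc i)) (reciprocityCoeff (suc i) p) x))
                                                        (eval-reciprocity (suc i) p x))) (remainder-+ i x)

  -- Modulo `p` the reciprocity polynomial equals `p * (suc i * powSum i x)`, so integrality of the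
  -- latter after division by `p` is read off from the coefficients of the former. The next lemma is
  -- the converse.
  LocPoly⇒p∣C*S : ∀ i → (p ≡ 2 → i ≡ 0 ⊎ 2 ∣ suc i) → LocPoly 1 (λ x → suc i * powSum i x) →
                  ∀ j → j < suc i → p ∣ (suc i C suc j) * powSum (i ∸ j) p
  LocPoly⇒p∣C*S i h F-poly j j<1+i = LocPoly⇒p∣coeff (suc (suc i)) (reciprocityCoeff (suc i) p)
    (LocPoly-cong (λ x → sym (reciprocity-coeffs i x)) (LocPoly-+ (remainder-LocPoly i h) (LocPoly-p* F-poly)))
    (suc j) (s<s j<1+i)

  p∣C*S⇒LocPoly : ∀ i → (p ≡ 2 → i ≡ 0 ⊎ 2 ∣ suc i) → (∀ j → j < suc i → p ∣ (suc i C suc j) * powSum (i ∸ j) p) →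
                  LocPoly 1 (λ x → suc i * powSum i x)
  p∣C*S⇒LocPoly i h p∣ = LocPoly-p*⁻ (LocPoly-∸
    (LocPoly-cong (reciprocity-coeffs i) (p∣coeff⇒LocPoly (suc (suc i)) (reciprocityCoeff (suc i) p) λ where
      zero    _     → p ∣0
      (suc j) 1+j<  → p∣ j (≤-pred 1+j<)))
    (remainder-LocPoly i h))

-- Binomial coefficients, power sums and digit sums modulo p

digitSumAux-0 : ∀ f k → digitSumAux f k 0 ≡ 0
digitSumAux-0 zero    k = refl
digitSumAux-0 (suc f) k = digitSumAux-0 f k

digitSumAux-fuel : ∀ f g k x → x < f → x < g → digitSumAux f k x ≡ digitSumAux g k x
digitSumAux-fuel f       g       k zero      _   _   = trans (digitSumAux-0 f k) (sym (digitSumAux-0 g k))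
digitSumAux-fuel (suc f) (suc g) k x@(suc _) x<f x<g = cong (λ z → x % 2+ k + z)
  (digitSumAux-fuel f g k (x / 2+ k) (<-≤-trans x/p<x (≤-pred x<f)) (<-≤-trans x/p<x (≤-pred x<g)))
  where
  x/p<x : x / 2+ k < x
  x/p<x = m/n<m x (2+ k) (s<s z<s)

digitSum-0 : ∀ p → digitSum p 0 ≡ 0
digitSum-0 zero          = refl
digitSum-0 (suc zero)    = refl
digitSum-0 (suc (suc k)) = refl

powSum-0 : ∀ x → powSum 0 x ≡ x
powSum-0 zero    = refl
powSum-0 (suc x) = trans (+-comm (powSum 0 x) 1) (cong suc (powSum-0 x))

module _ {p : ℕ} .{{_ : NonZero p}} (1<p : 1 < p) where

  digitSum-step : ∀ x → digitSum p x ≡ x % p + digitSum p (x / p)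
  digitSum-step = step 1<p
    where
    step : ∀ {p} .{{_ : NonZero p}} → 1 < p → ∀ x → digitSum p x ≡ x % p + digitSum p (x / p)
    step {suc zero}    (s≤s ()) x
    step {suc (suc k)} _        zero      = sym (digitSumAux-0 1 k)
    step {suc (suc k)} 1<p      x@(suc _) = cong (λ z → x % 2+ k + z)
      (digitSumAux-fuel x (suc (x / 2+ k)) k (x / 2+ k) (m/n<m x (2+ k) 1<p) (n<1+n _))

  digitSum-digit : ∀ a m → a < p → digitSum p (a + m * p) ≡ a + digitSum p m
  digitSum-digit a m a<p = trans (digitSum-step (a + m * p)) (cong₂ (λ y z → y + digitSum p z)
    (trans ([m+kn]%n≡m%n a m p) (m<n⇒m%n≡m a<p))
    (trans (+-distrib-/-∣ʳ a (n∣m*n m)) (cong₂ _+_ (m<n⇒m/n≡0 a<p) (m*n/n≡m m p))))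

  digitSum-small : ∀ a → a < p → digitSum p a ≡ a
  digitSum-small a a<p = trans (cong (digitSum p) (sym (+-identityʳ a)))
    (trans (digitSum-digit a 0 a<p) (trans (cong (λ z → a + z) (digitSum-0 p)) (+-identityʳ a)))

  -- Every power of p is congruent to 1 modulo q = p − 1.
  digitSum-mod : ∀ {q} → p ≡ suc q → ∀ x → Σ ℕ λ z → x ≡ digitSum p x + z * q
  digitSum-mod {q} p≡1+q = <-rec _ step
    where
    step : ∀ x → (∀ {y} → y < x → Σ ℕ λ z → y ≡ digitSum p y + z * q) → Σ ℕ λ z → x ≡ digitSum p x + z * q
    step zero      rec = 0 , sym (trans (+-identityʳ _) (digitSum-0 p))
    step x@(suc _) rec with rec (m/n<m x p 1<p)
    ... | z , eq = z + y , (begin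
      x                                               ≡⟨ m≡m%n+[m/n]*n x p ⟩
      x % p + y * p                                   ≡⟨ cong (λ w → x % p + w) (trans (cong (y *_) p≡1+q) (*-suc y q)) ⟩
      x % p + (y + y * q)                             ≡⟨ cong (λ w → x % p + (w + y * q)) eq ⟩
      x % p + (digitSum p y + z * q + y * q)          ≡⟨ rearrange (x % p) (digitSum p y) z y q ⟩
      x % p + digitSum p y + (z + y) * q              ≡⟨ cong (_+ (z + y) * q) (digitSum-step x) ⟨
      digitSum p x + (z + y) * q                      ∎)
      where
      open ≡-Reasoning
      y = x / p
      rearrange : ∀ a d z y q → a + (d + z * q + y * q) ≡ a + d + (z + y) * q
      rearrange = solve-∀

  digitSum≤ : ∀ x → digitSum p x ≤ x
  digitSum≤ x with digitSum-mod (sym (suc-pred p)) x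
  ... | z , eq = subst (digitSum p x ≤_) (sym eq) (m≤m+n _ _)

  digitSum-pos : ∀ x → 1 ≤ x → 1 ≤ digitSum p x
  digitSum-pos = <-rec _ step
    where
    step : ∀ x → (∀ {y} → y < x → 1 ≤ y → 1 ≤ digitSum p y) → 1 ≤ x → 1 ≤ digitSum p x
    step x@(suc _) rec 1≤x with x <? p
    ... | yes x<p = subst (1 ≤_) (sym (digitSum-small x x<p)) 1≤x
    ... | no  x≮p = subst (1 ≤_) (sym (digitSum-step x))
      (≤-trans (rec (m/n<m x p 1<p) (m≥n⇒m/n>0 {x} {p} (≮⇒≥ x≮p))) (m≤n+m _ (x % p)))

module _ {p q : ℕ} (p-prime : Prime p) (p≡1+q : p ≡ suc q) where

  private
    instance
      p-nonZero : NonZero p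
      p-nonZero = prime⇒nonZero p-prime

    1<p′ : 1 < p
    1<p′ = 1<p p-prime

    q<p : q < p
    q<p = subst (q <_) (sym p≡1+q) (n<1+n q)

    0<q : 0 < q
    0<q = ≤-pred (subst (1 <_) p≡1+q 1<p′)

    infix 4 _≈_
    record _≈_ (a b : ℕ) : Set where
      constructor mod
      field residues : a % p ≡ b % p
    open _≈_

    ≡⇒≈ : ∀ {a b} → a ≡ b → a ≈ b
    ≡⇒≈ a≡b = mod (cong (_% p) a≡b)

    ≈-sym : ∀ {a b} → a ≈ b → b ≈ a
    ≈-sym (mod a≈b) = mod (sym a≈b)

    ≈-trans : ∀ {a b c} → a ≈ b → b ≈ c → a ≈ c
    ≈-trans (mod a≈b) (mod b≈c) = mod (trans a≈b b≈c)

    ≈-+ : ∀ {a b c d} → a ≈ b → c ≈ d → a + c ≈ b + d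
    ≈-+ {a} {b} {c} {d} (mod a≈b) (mod c≈d) = mod
      (trans (%-distribˡ-+ a c p) (trans (cong₂ (λ y z → (y + z) % p) a≈b c≈d) (sym (%-distribˡ-+ b d p))))

    ≈-* : ∀ {a b c d} → a ≈ b → c ≈ d → a * c ≈ b * d
    ≈-* {a} {b} {c} {d} (mod a≈b) (mod c≈d) = mod
      (trans (%-distribˡ-* a c p) (trans (cong₂ (λ y z → (y * z) % p) a≈b c≈d) (sym (%-distribˡ-* b d p))))

    ∣⇒≈0 : ∀ {a} → p ∣ a → a ≈ 0
    ∣⇒≈0 {a} p∣a = mod (trans (n∣m⇒m%n≡0 a p p∣a) (sym (n∣m⇒m%n≡0 0 p (p ∣0))))

    ∣-resp-≈ : ∀ {a b} → a ≈ b → p ∣ a → p ∣ b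
    ∣-resp-≈ {a} {b} (mod a≈b) p∣a = m%n≡0⇒n∣m b p (trans (sym a≈b) (n∣m⇒m%n≡0 a p p∣a))

    ≈⇒∣ : ∀ a {c} → a + c ≈ a → p ∣ c
    ≈⇒∣ a {c} (mod eq) = ∣m+n∣m⇒∣n (subst (p ∣_) (sym lemma) (n∣m*n ((a + c) / p))) (n∣m*n (a / p))
      where
      open ≡-Reasoning
      rearrange : ∀ a q c → a + (q + c) ≡ a + q + c
      rearrange = solve-∀
      lemma : a / p * p + c ≡ (a + c) / p * p
      lemma = +-cancelˡ-≡ (a % p) _ _ (begin
        a % p + (a / p * p + c)          ≡⟨ rearrange (a % p) (a / p * p) c ⟩
        a % p + a / p * p + c            ≡⟨ cong (_+ c) (m≡m%n+[m/n]*n a p) ⟨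
        a + c                            ≡⟨ m≡m%n+[m/n]*n (a + c) p ⟩
        (a + c) % p + (a + c) / p * p    ≡⟨ cong (_+ (a + c) / p * p) eq ⟩
        a % p + (a + c) / p * p          ∎)

    p∤small : ∀ {a} → 1 ≤ a → a < p → ¬ p ∣ a
    p∤small {suc a} _ a<p p∣a = <⇒≱ a<p (∣⇒≤ p∣a)

  p∤n! : ∀ n → n < p → ¬ p ∣ n !
  p∤n! zero    _   = p∤1 p-prime
  p∤n! (suc n) n<p = p∤* p-prime (p∤small z<s n<p) (p∤n! n (<⇒≤ n<p))

  p∤aCb : ∀ {a b} → b ≤ a → a < p → ¬ p ∣ a C b
  p∤aCb {a} {b} b≤a a<p p∣aCb = p∤n! a a<p (subst (p ∣_) (m/n*n≡m (k![n∸k]!∣n! b≤a))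
    (∣m⇒∣m*n (b ! * (a ∸ b) !) (subst (p ∣_) (nCk≡n!/k![n-k]! b≤a) p∣aCb)))
    where instance _ = b !* (a ∸ b) !≢0

  p∣pCk : ∀ k → suc k < p → p ∣ p C suc k
  p∣pCk k k<p with euclidsLemma (suc k) (p C suc k) p-prime
    (subst (λ z → z ∣ suc k * (z C suc k)) (sym p≡1+q) (subst (suc q ∣_) (sym ([1+k]*[1+n]C[1+k]≡[1+n]*nCk q k)) (m∣m*n (q C k))))
  ... | inj₁ p∣1+k = ⊥-elim (p∤small z<s k<p p∣1+k)
  ... | inj₂ p∣pCk = p∣pCk

  fermat : ∀ a → a ^ p ≈ a
  fermat zero    = ≡⇒≈ (trans (cong (0 ^_) p≡1+q) refl)
  fermat (suc a) = ≈-trans (≡⇒≈ (trans (binomial p 1 a) (cong (λ z → t 0 + z) (trans (cong (λ n → ∑ n (t ∘ suc)) p≡1+q) (∑-last q (t ∘ suc))))))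
    (≈-trans (≈-+ (≈-trans (≡⇒≈ (trans (*-identityˡ _) (*-identityˡ (a ^ p)))) (fermat a)) (≈-+ (∣⇒≈0 middle) (≡⇒≈ last)))
      (≡⇒≈ (+-comm a 1)))
    where
    t : ℕ → ℕ
    t k = (p C k) * (1 ^ k * a ^ (p ∸ k))
    middle : p ∣ ∑ q (t ∘ suc)
    middle = ∑-∣ p q (λ k k<q → ∣m⇒∣m*n _ (p∣pCk k (≤-<-trans k<q q<p)))
    last : t (suc q) ≡ 1
    last = trans (cong t (sym p≡1+q)) (trans (cong₂ (λ c e → c * (1 ^ p * a ^ e)) (nCn≡1 p) (n∸n≡0 p))
                 (trans (*-identityˡ _) (trans (*-identityʳ _) (^-zeroˡ p))))

  -- By Fermat an exponent may drop by `p - 1` as long as it stays positive; hence `suc k` on the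
  -- right.
  powSum-periodic : ∀ k x → powSum (k + p) x ≈ powSum (suc k) x
  powSum-periodic k zero    = ≡⇒≈ refl
  powSum-periodic k (suc x) = ≈-+ (powSum-periodic k x)
    (≈-trans (≡⇒≈ (^-distribˡ-+-* (suc x) k p))
      (≈-trans (≈-* (≡⇒≈ {suc x ^ k} refl) (fermat (suc x))) (≡⇒≈ (*-comm (suc x ^ k) (suc x)))))

  -- `reciprocity` at `x = 1` and exponent `k + 1`: every summand on the left contains a power of
  -- `p`, and on the right induction disposes of all but `(k+1) S_k(p)`, where `k + 1 < p`.
  p∣powSum-small : ∀ k → k < q → p ∣ powSum k p
  p∣powSum-small = <-rec _ step
    where
    step : ∀ k → (∀ {l} → l < k → l < q → p ∣ powSum l p) → k < q → p ∣ powSum k p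
    step k rec k<q with euclidsLemma (suc k C 1) (1 ^ 1 * powSum k p) p-prime
      (∣m+n∣m⇒∣n (subst (p ∣_) (trans (reciprocity (suc k) p 1) (+-comm ((suc k C 1) * (1 ^ 1 * powSum k p)) _)) left) right)
      where
      left : p ∣ ∑ (suc k) (λ i → (suc k C i) * (p ^ (suc k ∸ i) * powSum i 1))
      left = ∑-∣ p (suc k) λ i i<1+k → ∣n⇒∣m*n (suc k C i) (∣m⇒∣m*n (powSum i 1)
        (subst (λ e → p ∣ p ^ e) (sym (+-∸-assoc 1 (≤-pred i<1+k))) (m∣m*n (p ^ (k ∸ i)))))
      right : p ∣ ∑ k (λ j → (suc k C suc (suc j)) * (1 ^ suc (suc j) * powSum (k ∸ suc j) p))
      right = ∑-∣ p k λ j j<k → ∣n⇒∣m*n (suc k C suc (suc j)) (∣n⇒∣m*n (1 ^ suc (suc j))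
        (rec (∸-monoʳ-< z<s j<k) (≤-<-trans (m∸n≤m k (suc j)) k<q)))
    ... | inj₁ p∣1+k = ⊥-elim (p∤small z<s (≤-<-trans k<q q<p) (subst (p ∣_) (nC1≡n (suc k)) p∣1+k))
    ... | inj₂ p∣σ   = subst (p ∣_) (*-identityˡ (powSum k p)) p∣σ

  p∣powSum : ∀ k → ¬ q ∣ k → p ∣ powSum k p
  p∣powSum = <-rec _ step
    where
    step : ∀ k → (∀ {l} → l < k → ¬ q ∣ l → p ∣ powSum l p) → ¬ q ∣ k → p ∣ powSum k p
    step k rec ∤k with k <? q
    ... | yes k<q = p∣powSum-small k k<q
    ... | no  k≮q with m≤n⇒∃[o]m+o≡n (≮⇒≥ k≮q)
    ...   | zero  , refl = ⊥-elim (∤k (subst (q ∣_) (sym (+-identityʳ q)) ∣-refl))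
    ...   | suc l , refl = ∣-resp-≈ (≈-sym (≈-trans (≡⇒≈ (cong (λ e → powSum e p) shift)) (powSum-periodic l p)))
              (rec (m<n+m (suc l) 0<q) (λ ∣l → ∤k (∣m∣n⇒∣m+n ∣-refl ∣l)))
      where
      shift : q + suc l ≡ l + p
      shift = trans (+-comm q (suc l)) (trans (sym (+-suc l q)) (cong (λ w → l + w) (sym p≡1+q)))

  -- For exponent `q` each of the `q` nonzero residues contributes 1, so the sum is congruent to
  -- `q`; periodicity does the rest. Writing `suc z` excludes exponent 0, where the sum is `p`.
  p∤powSum : ∀ z → ¬ p ∣ powSum (suc z * q) p
  p∤powSum zero p∣ = p∤small 0<q q<p (∣-resp-≈ σ≈q p∣)
    where
    fermat′ : ∀ a → suc a < p → suc a ^ q ≈ 1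
    -- With `(a+1)^q = 1 + b`, Fermat reads `(a+1) + (a+1)b ≈ a+1`, so `p` divides `(a+1)b` and
    -- hence `b`.
    fermat′ a a<p with suc a ^ q in eq | m^n>0 (suc a) q
    ... | suc b | _ with euclidsLemma (suc a) b p-prime (≈⇒∣ (suc a) (≈-trans (≡⇒≈ (trans (sym (*-suc (suc a) b))
                           (trans (cong (suc a *_) (sym eq)) (cong (suc a ^_) (sym p≡1+q))))) (fermat (suc a))))
    ...   | inj₁ p∣a = ⊥-elim (p∤small z<s a<p p∣a)
    ...   | inj₂ p∣b = ≈-+ (≡⇒≈ {1} refl) (∣⇒≈0 p∣b)
    count : ∀ x → x ≤ q → powSum q x ≈ x
    count zero    _   = ≡⇒≈ refl
    count (suc x) x<q = ≈-trans (≈-+ (count x (<⇒≤ x<q)) (fermat′ x (≤-<-trans x<q q<p))) (≡⇒≈ (+-comm x 1))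
    p∣p^ : ∀ e → 0 < e → p ∣ p ^ e
    p∣p^ (suc e) _ = m∣m*n (p ^ e)
    σ≈q : powSum (1 * q) p ≈ q
    σ≈q = ≈-trans (≡⇒≈ (trans (cong₂ powSum (*-identityˡ q) p≡1+q) (cong (λ z → powSum q q + z ^ q) (sym p≡1+q))))
      (≈-trans (≈-+ (count q ≤-refl) (∣⇒≈0 (p∣p^ q 0<q))) (≡⇒≈ (+-identityʳ q)))
  p∤powSum (suc z) p∣ with m≤n⇒∃[o]m+o≡n (≤-trans 0<q (m≤m+n q (z * q)))
  ... | k , 1+k≡ = p∤powSum z (∣-resp-≈ (≈-trans (≡⇒≈ (cong (λ e → powSum e p) shift))
                     (≈-trans (powSum-periodic k p) (≡⇒≈ (cong (λ e → powSum e p) 1+k≡)))) p∣)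
    where
    shift : suc (suc z) * q ≡ k + p
    shift = trans (+-comm q (suc z * q)) (trans (cong (_+ q) (sym 1+k≡)) (trans (sym (+-suc k q)) (cong (λ w → k + w) (sym p≡1+q))))

  private
    pascal-p : ∀ n → (n C q) + (n C p) ≡ suc n C p
    pascal-p n = subst (λ z → (n C q) + (n C z) ≡ suc n C z) (sym p≡1+q) (nCk+nC[k+1]≡[n+1]C[k+1] n q)

    -- This and the next lemma compare coefficients in `(1+X)^(n+p) ≡ (1+X)^n (1+X^p)`; Pascal's
    -- rule propagates them from row `p`, whose inner entries vanish modulo `p`.
    [n+p]Ck≈nCk : ∀ n k → k < p → (n + p) C k ≈ n C k
    [n+p]Ck≈nCk n       zero    _   = ≡⇒≈ refl
    [n+p]Ck≈nCk zero    (suc k) k<p = ∣⇒≈0 (p∣pCk k k<p)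
    [n+p]Ck≈nCk (suc n) (suc k) k<p = ≈-trans (≡⇒≈ (sym (nCk+nC[k+1]≡[n+1]C[k+1] (n + p) k)))
      (≈-trans (≈-+ ([n+p]Ck≈nCk n k (<⇒≤ k<p)) ([n+p]Ck≈nCk n (suc k) k<p)) (≡⇒≈ (nCk+nC[k+1]≡[n+1]C[k+1] n k)))

    [n+p]C[k+p]≈ : ∀ n k → (n + p) C (k + p) ≈ (n C (k + p)) + (n C k)
    [n+p]C[k+p]≈ zero    zero    = ≡⇒≈ (trans (nCn≡1 p) (cong (_+ 1) (sym (k>n⇒nCk≡0 {0} {p} (<⇒≤ 1<p′)))))
    [n+p]C[k+p]≈ zero    (suc k) = ≡⇒≈ (k>n⇒nCk≡0 (m<n+m p {suc k} z<s))
    [n+p]C[k+p]≈ (suc n) zero    = ≈-trans (≡⇒≈ (sym (pascal-p (n + p))))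
      (≈-trans (≈-+ ([n+p]Ck≈nCk n q q<p) ([n+p]C[k+p]≈ n zero))
        (≡⇒≈ (trans (sym (+-assoc (n C q) (n C p) 1)) (cong (_+ 1) (pascal-p n)))))
    [n+p]C[k+p]≈ (suc n) (suc k) = ≈-trans (≡⇒≈ (sym (nCk+nC[k+1]≡[n+1]C[k+1] (n + p) (k + p))))
      (≈-trans (≈-+ ([n+p]C[k+p]≈ n k) ([n+p]C[k+p]≈ n (suc k)))
        (≡⇒≈ (trans (interchange (n C (k + p)) (n C k) (n C suc (k + p)) (n C suc k))
          (cong₂ _+_ (nCk+nC[k+1]≡[n+1]C[k+1] n (k + p)) (nCk+nC[k+1]≡[n+1]C[k+1] n k)))))
      where
      interchange : ∀ a b c d → a + b + (c + d) ≡ a + c + (b + d)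
      interchange = solve-∀

    carry : ∀ a m → a + suc m * p ≡ a + m * p + p
    carry a m = shift a m p
      where
      shift : ∀ a m p → a + suc m * p ≡ a + m * p + p
      shift = solve-∀

  -- Adding `p` to the upper argument acts on the quotients `m`, `k` as Pascal's rule and leaves the
  -- last digits alone.
  lucas : ∀ m k {a b} → a < p → b < p → (a + m * p) C (b + k * p) ≈ (a C b) * (m C k)
  lucas zero zero {a} {b} a<p b<p = ≡⇒≈ (trans (cong₂ _C_ (+-identityʳ a) (+-identityʳ b)) (sym (*-identityʳ _)))
  lucas zero (suc k) {a} {b} a<p b<p = ≡⇒≈ (trans
    (k>n⇒nCk≡0 (≤-trans (subst (_< p) (sym (+-identityʳ a)) a<p) (≤-trans (m≤m+n p (k * p)) (m≤n+m _ b)))) (sym (*-zeroʳ (a C b))))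
  lucas (suc m) zero {a} {b} a<p b<p = ≈-trans (≡⇒≈ (cong (_C (b + 0)) (carry a m)))
    (≈-trans ([n+p]Ck≈nCk (a + m * p) (b + 0) (subst (_< p) (sym (+-identityʳ b)) b<p)) (lucas m 0 a<p b<p))
  lucas (suc m) (suc k) {a} {b} a<p b<p = ≈-trans (≡⇒≈ (cong₂ _C_ (carry a m) (carry b k)))
    (≈-trans ([n+p]C[k+p]≈ (a + m * p) (b + k * p))
      (≈-trans (≈-+ (≈-trans (≡⇒≈ (cong ((a + m * p) C_) (sym (carry b k)))) (lucas m (suc k) a<p b<p)) (lucas m k a<p b<p))
        (≡⇒≈ (trans (sym (*-distribˡ-+ (a C b) _ _))
          (cong ((a C b) *_) (trans (+-comm (m C suc k) (m C k)) (nCk+nC[k+1]≡[n+1]C[k+1] m k)))))))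

  private
    lucas-digit : ∀ m k → m C k ≈ (m % p C k % p) * (m / p C k / p)
    lucas-digit m k = ≈-trans (≡⇒≈ (cong₂ _C_ (m≡m%n+[m/n]*n m p) (m≡m%n+[m/n]*n k p)))
      (lucas (m / p) (k / p) (m%n<n m p) (m%n<n k p))

    s : ℕ → ℕ
    s = digitSum p

    s-step : ∀ x → s x ≡ x % p + s (x / p)
    s-step = digitSum-step 1<p′

  -- By Lucas every digit of `k` is at most the corresponding digit of `m`; equal sums then force
  -- equal digits.
  p∤C⇒digitSum≤ : ∀ m k → ¬ p ∣ m C k → digitSum p k ≤ digitSum p m × (digitSum p k ≡ digitSum p m → k ≡ m)
  p∤C⇒digitSum≤ = <-rec _ step
    where
    step : ∀ m → (∀ {m′} → m′ < m → ∀ k → ¬ p ∣ m′ C k → s k ≤ s m′ × (s k ≡ s m′ → k ≡ m′)) →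
           ∀ k → ¬ p ∣ m C k → s k ≤ s m × (s k ≡ s m → k ≡ m)
    step zero      rec zero    p∤C = ≤-refl , λ _ → refl
    step zero      rec (suc k) p∤C = ⊥-elim (p∤C (p ∣0))
    step m@(suc _) rec k       p∤C with k % p ≤? m % p
    ... | no  b≰a = ⊥-elim (p∤C (∣-resp-≈ (≈-sym (≈-trans (lucas-digit m k)
                      (≡⇒≈ (cong (_* (m / p C k / p)) (k>n⇒nCk≡0 (≰⇒> b≰a)))))) (p ∣0)))
    ... | yes b≤a with rec (m/n<m m p 1<p′) (k / p) (λ p∣C′ → p∤C (∣-resp-≈ (≈-sym (lucas-digit m k)) (∣n⇒∣m*n (m % p C k % p) p∣C′)))
    ...   | s≤ , s≡⇒≡ = subst₂ _≤_ (sym (s-step k)) (sym (s-step m)) (+-mono-≤ b≤a s≤) , equality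
      where
      equality : s k ≡ s m → k ≡ m
      equality s≡ with trans (sym (s-step k)) (trans s≡ (s-step m)) | m≤n⇒m<n∨m≡n b≤a
      ... | eq | inj₁ b<a = ⊥-elim (<-irrefl eq (+-mono-<-≤ b<a s≤))
      ... | eq | inj₂ b≡a = trans (m≡m%n+[m/n]*n k p) (trans (cong₂ (λ y z → y + z * p) b≡a
              (s≡⇒≡ (+-cancelˡ-≡ (k % p) _ _ (trans eq (cong (_+ s (m / p)) (sym b≡a))))))
              (sym (m≡m%n+[m/n]*n m p)))

  -- Spend `t` greedily on the digits of `m` from the lowest up: the digit of `k` is `t ⊓ (m % p)`,
  -- and the quotients handle what is left of `t`.
  digitSum≥⇒∃p∤C : ∀ m t → t ≤ digitSum p m → Σ ℕ λ k → ¬ p ∣ m C k × digitSum p k ≡ t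
  digitSum≥⇒∃p∤C = <-rec _ step
    where
    step : ∀ m → (∀ {m′} → m′ < m → ∀ t → t ≤ s m′ → Σ ℕ λ k → ¬ p ∣ m′ C k × s k ≡ t) →
           ∀ t → t ≤ s m → Σ ℕ λ k → ¬ p ∣ m C k × s k ≡ t
    step zero      rec t t≤ = 0 , p∤1 p-prime , trans (digitSum-0 p) (sym (n≤0⇒n≡0 (subst (t ≤_) (digitSum-0 p) t≤)))
    step m@(suc _) rec t t≤ with rec (m/n<m m p 1<p′) (t ∸ (t ⊓ (m % p))) t∸b≤
      where
      t∸b≤ : t ∸ (t ⊓ (m % p)) ≤ s (m / p)
      t∸b≤ with ≤-total t (m % p)
      ... | inj₁ t≤a = subst (_≤ s (m / p)) (sym (trans (cong (t ∸_) (m≤n⇒m⊓n≡m t≤a)) (n∸n≡0 t))) z≤n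
      ... | inj₂ a≤t = subst (_≤ s (m / p)) (sym (cong (t ∸_) (m≥n⇒m⊓n≡n a≤t)))
              (m≤n+o⇒m∸n≤o t (m % p) (subst (t ≤_) (s-step m) t≤))
    ... | k , p∤C , s≡ = b + k * p , p∤C′ , trans (digitSum-digit 1<p′ b k b<p) (trans (cong (λ z → b + z) s≡) (m+[n∸m]≡n (m⊓n≤m t (m % p))))
      where
      b = t ⊓ (m % p)
      b<p : b < p
      b<p = ≤-<-trans (m⊓n≤n t (m % p)) (m%n<n m p)
      p∤C′ : ¬ p ∣ m C (b + k * p)
      p∤C′ p∣C = p∤* p-prime (p∤aCb {m % p} {b} (m⊓n≤n t (m % p)) (m%n<n m p)) p∤C
        (∣-resp-≈ (≈-trans (≡⇒≈ (cong (_C (b + k * p)) (m≡m%n+[m/n]*n m p))) (lucas (m / p) k (m%n<n m p) b<p)) p∣C)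

  -- Put `k = i - j`. The only threat is `k > 0` with `q ∣ k` and `p ∤ C(i+1,k)`. Then `q` divides
  -- the positive number `s(k)`, so `q ≤ s(k) ≤ s(i+1) ≤ q`, and equality gives `k = i + 1`, which
  -- is absurd.
  digitSum<p⇒p∣C*S : ∀ i → digitSum p (suc i) < p → ∀ j → j < suc i → p ∣ (suc i C suc j) * powSum (i ∸ j) p
  digitSum<p⇒p∣C*S i s<p j j<1+i with q ∣? (i ∸ j)
  ... | no  ∤k = ∣n⇒∣m*n (suc i C suc j) (p∣powSum (i ∸ j) ∤k)
  ... | yes ∣k with (i ∸ j) ≟ 0 | p ∣? (suc i C (i ∸ j))
  ...   | yes k≡0 | _ = ∣n⇒∣m*n (suc i C suc j) (subst (λ k → p ∣ powSum k p) (sym k≡0) (subst (p ∣_) (sym (powSum-0 p)) ∣-refl))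
  ...   | no  k≢0 | yes p∣C = ∣m⇒∣m*n (powSum (i ∸ j) p) (subst (p ∣_) (sym (nCk≡nC[n∸k] j<1+i)) p∣C)
  ...   | no  k≢0 | no  p∤C with p∤C⇒digitSum≤ (suc i) (i ∸ j) p∤C | digitSum-mod 1<p′ p≡1+q (i ∸ j)
  ...     | s≤ , s≡⇒≡ | z , k≡ = ⊥-elim (<-irrefl (s≡⇒≡ (≤-antisym s≤ (≤-trans (≤-pred (subst (s (suc i) <_) p≡1+q s<p)) q≤s))) (s≤s (m∸n≤m i j)))
    where
    q∣s : q ∣ s (i ∸ j)
    q∣s = ∣m+n∣m⇒∣n (subst (q ∣_) (trans k≡ (+-comm (s (i ∸ j)) _)) ∣k) (n∣m*n z)
    q≤s : q ≤ s (i ∸ j)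
    q≤s = ∣⇒≤ {{>-nonZero (digitSum-pos 1<p′ (i ∸ j) (n≢0⇒n>0 k≢0))}} q∣s

  -- Take `k` with `s(k) = q` and `p ∤ C(i+1,k)`. Then `k` is a positive multiple of `q`, so
  -- `p ∤ S_k(p)`; and `k ≠ i + 1` because `s(i+1) ≥ p > q`. The witness is `j = i - k`.
  digitSum≥p⇒∃p∤C*S : ∀ i → p ≤ digitSum p (suc i) → Σ ℕ λ j → j < suc i × ¬ p ∣ (suc i C suc j) * powSum (i ∸ j) p
  digitSum≥p⇒∃p∤C*S i s≥p with digitSum≥⇒∃p∤C (suc i) q (≤-trans (<⇒≤ q<p) s≥p)
  ... | k , p∤C , s≡ with k ≤? i | digitSum-mod 1<p′ p≡1+q k
  ...   | no  k≰i | _ with m≤n⇒m<n∨m≡n (≰⇒> k≰i)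
  ...     | inj₁ 1+i<k = ⊥-elim (p∤C (subst (p ∣_) (sym (k>n⇒nCk≡0 1+i<k)) (p ∣0)))
  ...     | inj₂ refl  = ⊥-elim (<-irrefl (sym s≡) (<-≤-trans q<p s≥p))
  digitSum≥p⇒∃p∤C*S i s≥p | k , p∤C , s≡ | yes k≤i | z , k≡ = i ∸ k , s≤s (m∸n≤m i k) , p∤* p-prime
        (λ p∣C → p∤C (subst (p ∣_) (trans (cong (suc i C_) (sym (+-∸-assoc 1 k≤i))) (sym (nCk≡nC[n∸k] (≤-trans k≤i (n≤1+n i))))) p∣C))
        (λ p∣σ → p∤powSum z (subst (λ e → p ∣ powSum e p) (trans (m∸[m∸n]≡n k≤i) (trans k≡ (cong (_+ z * q) s≡))) p∣σ))

-- Finite differences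

Δ : (ℕ → ℤ) → ℕ → ℤ
Δ f x = f (suc x) ℤ.- f x

Δ^ : ℕ → (ℕ → ℤ) → ℕ → ℤ
Δ^ zero    f = f
Δ^ (suc k) f = Δ (Δ^ k f)

Δ^-cong : ∀ k {f g} → (∀ x → f x ≡ g x) → ∀ x → Δ^ k f x ≡ Δ^ k g x
Δ^-cong zero    eq x = eq x
Δ^-cong (suc k) eq x = cong₂ ℤ._-_ (Δ^-cong k eq (suc x)) (Δ^-cong k eq x)

Δ^-Δ : ∀ k f x → Δ^ (suc k) f x ≡ Δ^ k (Δ f) x
Δ^-Δ zero    f x = refl
Δ^-Δ (suc k) f x = cong₂ ℤ._-_ (Δ^-Δ k f (suc x)) (Δ^-Δ k f x)

Δ^-scale : ∀ k c f x → Δ^ k (λ y → c ℤ.* f y) x ≡ c ℤ.* Δ^ k f x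
Δ^-scale zero    c f x = refl
Δ^-scale (suc k) c f x = trans (cong₂ ℤ._-_ (Δ^-scale k c f (suc x)) (Δ^-scale k c f x))
                               (factor-out c (Δ^ k f (suc x)) (Δ^ k f x))
  where
  factor-out : ∀ c a b → c ℤ.* a ℤ.- c ℤ.* b ≡ c ℤ.* (a ℤ.- b)
  factor-out = ℤ-Solver.solve-∀

Δ^-const : ∀ k c f x → Δ^ (suc k) (λ y → c ℤ.+ f y) x ≡ Δ^ (suc k) f x
Δ^-const zero    c f x = cancel c (f (suc x)) (f x)
  where
  cancel : ∀ c a b → (c ℤ.+ a) ℤ.- (c ℤ.+ b) ≡ a ℤ.- b
  cancel = ℤ-Solver.solve-∀
Δ^-const (suc k) c f x = cong₂ ℤ._-_ (Δ^-const k c f (suc x)) (Δ^-const k c f x)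

-- The Leibniz rule stops after two terms because the other factor is linear. The offset `a` is 1
-- for Horner evaluation at `suc y` and 2 for powers of `2 + y`.
Δ^-leibniz : ∀ k a f x → Δ^ (suc k) (λ y → + (a + y) ℤ.* f y) x ≡
             + (a + x) ℤ.* Δ^ (suc k) f x ℤ.+ + suc k ℤ.* Δ^ k f (suc x)
Δ^-leibniz zero    a f x = trans (cong (λ z → + z ℤ.* f (suc x) ℤ.- + (a + x) ℤ.* f x) (+-suc a x))
                                 (expand (+ (a + x)) (f (suc x)) (f x))
  where
  expand : ∀ y u v → (+ 1 ℤ.+ y) ℤ.* u ℤ.- y ℤ.* v ≡ y ℤ.* (u ℤ.- v) ℤ.+ + 1 ℤ.* u
  expand = ℤ-Solver.solve-∀
Δ^-leibniz (suc k) a f x = trans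
  (cong₂ ℤ._-_ (trans (Δ^-leibniz k a f (suc x)) (cong (λ z → + z ℤ.* Δ^ (suc k) f (suc x) ℤ.+ + suc k ℤ.* Δ^ k f (2+ x)) (+-suc a x)))
               (Δ^-leibniz k a f x))
  (expand (+ (a + x)) (+ suc k) (Δ^ k f (2+ x)) (Δ^ k f (suc x)) (Δ^ k f x))
  where
  expand : ∀ y k u v w →
    ((+ 1 ℤ.+ y) ℤ.* (u ℤ.- v) ℤ.+ k ℤ.* u) ℤ.- (y ℤ.* (v ℤ.- w) ℤ.+ k ℤ.* v) ≡
    y ℤ.* ((u ℤ.- v) ℤ.- (v ℤ.- w)) ℤ.+ (+ 1 ℤ.+ k) ℤ.* (u ℤ.- v)
  expand = ℤ-Solver.solve-∀

-- Induction along Horner's scheme: differencing kills the constant, and Leibniz leaves a multiple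
-- of `Δ^(k+1)` of the tail plus `k + 1` times its `Δ^k`.
k!∣Δ^k : ∀ P k x → Σ ℤ λ z → Δ^ k (λ y → evalℤ P (+ suc y)) x ≡ + (k !) ℤ.* z
k!∣Δ^k P       zero    x = evalℤ P (+ suc x) , sym (ℤₚ.*-identityˡ _)
k!∣Δ^k []      (suc k) x = + 0 , trans (vanish (suc k) x) (sym (ℤₚ.*-zeroʳ (+ (suc k !))))
  where
  vanish : ∀ k x → Δ^ k (λ _ → + 0) x ≡ + 0
  vanish zero    x = refl
  vanish (suc k) x = cong₂ ℤ._-_ (vanish k (suc x)) (vanish k x)
k!∣Δ^k (c ∷ P) (suc k) x with k!∣Δ^k P (suc k) x | k!∣Δ^k P k (suc x)
... | z , eq | w , eq′ = + suc x ℤ.* z ℤ.+ w , (begin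
  Δ^ (suc k) (λ y → c ℤ.+ + suc y ℤ.* evalℤ P (+ suc y)) x
    ≡⟨ Δ^-const k c _ x ⟩
  Δ^ (suc k) (λ y → + suc y ℤ.* evalℤ P (+ suc y)) x
    ≡⟨ Δ^-leibniz k 1 (λ y → evalℤ P (+ suc y)) x ⟩
  + suc x ℤ.* Δ^ (suc k) (λ y → evalℤ P (+ suc y)) x ℤ.+ + suc k ℤ.* Δ^ k (λ y → evalℤ P (+ suc y)) (suc x)
    ≡⟨ cong₂ (λ u v → + suc x ℤ.* u ℤ.+ + suc k ℤ.* v) (trans eq (cong (ℤ._* z) (ℤₚ.pos-* (suc k) (k !)))) eq′ ⟩
  + suc x ℤ.* (+ suc k ℤ.* + (k !) ℤ.* z) ℤ.+ + suc k ℤ.* (+ (k !) ℤ.* w)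
    ≡⟨ collect (+ suc x) (+ suc k) (+ (k !)) z w ⟩
  + suc k ℤ.* + (k !) ℤ.* (+ suc x ℤ.* z ℤ.+ w)
    ≡⟨ cong (ℤ._* (+ suc x ℤ.* z ℤ.+ w)) (ℤₚ.pos-* (suc k) (k !)) ⟨
  + (suc k !) ℤ.* (+ suc x ℤ.* z ℤ.+ w) ∎)
  where
  open ≡-Reasoning
  collect : ∀ x k f z w → x ℤ.* (k ℤ.* f ℤ.* z) ℤ.+ k ℤ.* (f ℤ.* w) ≡ k ℤ.* f ℤ.* (x ℤ.* z ℤ.+ w)
  collect = ℤ-Solver.solve-∀

-- The base is `2 + y` because that is the term gained from `powSum n (1 + y)` to
-- `powSum n (2 + y)`.
Δ^n-power : ∀ n x → Δ^ n (λ y → + ((2 + y) ^ n)) x ≡ + (n !)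
Δ^n-power zero    x = refl
Δ^n-power (suc n) x = begin
  Δ^ (suc n) (λ y → + ((2 + y) * (2 + y) ^ n)) x
    ≡⟨ Δ^-cong (suc n) (λ y → ℤₚ.pos-* (2 + y) ((2 + y) ^ n)) x ⟩
  Δ^ (suc n) (λ y → + (2 + y) ℤ.* + ((2 + y) ^ n)) x
    ≡⟨ Δ^-leibniz n 2 (λ y → + ((2 + y) ^ n)) x ⟩
  + (2 + x) ℤ.* Δ^ (suc n) (λ y → + ((2 + y) ^ n)) x ℤ.+ + suc n ℤ.* Δ^ n (λ y → + ((2 + y) ^ n)) (suc x)
    ≡⟨ cong₂ (λ u v → + (2 + x) ℤ.* u ℤ.+ + suc n ℤ.* v)
         (trans (cong₂ ℤ._-_ (Δ^n-power n (suc x)) (Δ^n-power n x)) (ℤₚ.+-inverseʳ (+ (n !)))) (Δ^n-power n (suc x)) ⟩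
  + (2 + x) ℤ.* + 0 ℤ.+ + suc n ℤ.* + (n !)
    ≡⟨ trans (cong (ℤ._+ (+ suc n ℤ.* + (n !))) (ℤₚ.*-zeroʳ (+ (2 + x)))) (ℤₚ.+-identityˡ _) ⟩
  + suc n ℤ.* + (n !)
    ≡⟨ ℤₚ.pos-* (suc n) (n !) ⟨
  + (suc n !) ∎
  where open ≡-Reasoning

-- The (n+1)-st difference of d · (1^n + ⋯ + x^n) is d · n!, whereas that of an
-- integer polynomial is divisible by (n+1)!.
1+n∣multiple : ∀ n d → IntPolyMultiple n d → suc n ∣ d
1+n∣multiple n d (P , ev) with k!∣Δ^k P (suc n) 0
... | z , eq = *-cancelʳ-∣ (n !) {{n !≢0}} (divides ∣ z ∣ (begin
  d * n !                        ≡⟨ cong ∣_∣ (trans (ℤₚ.pos-* d (n !)) (trans (sym difference) eq)) ⟩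
  ∣ + (suc n !) ℤ.* z ∣          ≡⟨ ℤₚ.abs-* (+ (suc n !)) z ⟩
  suc n ! * ∣ z ∣                ≡⟨ *-comm (suc n !) ∣ z ∣ ⟩
  ∣ z ∣ * (suc n * n !)          ∎))
  where
  open ≡-Reasoning
  step : ∀ x → Δ (λ y → + (d * powSum n (suc y))) x ≡ + d ℤ.* + ((2 + x) ^ n)
  step x = begin
    + (d * (powSum n (suc x) + (2 + x) ^ n)) ℤ.- + (d * powSum n (suc x))
      ≡⟨ cong₂ ℤ._-_ (ℤₚ.pos-* d _) (ℤₚ.pos-* d _) ⟩
    + d ℤ.* (+ powSum n (suc x) ℤ.+ + ((2 + x) ^ n)) ℤ.- + d ℤ.* + powSum n (suc x)
      ≡⟨ cancel (+ d) (+ powSum n (suc x)) (+ ((2 + x) ^ n)) ⟩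
    + d ℤ.* + ((2 + x) ^ n) ∎
    where
    cancel : ∀ d s t → d ℤ.* (s ℤ.+ t) ℤ.- d ℤ.* s ≡ d ℤ.* t
    cancel = ℤ-Solver.solve-∀
  difference : Δ^ (suc n) (λ y → evalℤ P (+ suc y)) 0 ≡ + d ℤ.* + (n !)
  difference = begin
    Δ^ (suc n) (λ y → evalℤ P (+ suc y)) 0          ≡⟨ Δ^-cong (suc n) (λ y → ev (suc y) z<s) 0 ⟩
    Δ^ (suc n) (λ y → + (d * powSum n (suc y))) 0   ≡⟨ Δ^-Δ n (λ y → + (d * powSum n (suc y))) 0 ⟩
    Δ^ n (Δ (λ y → + (d * powSum n (suc y)))) 0     ≡⟨ Δ^-cong n step 0 ⟩
    Δ^ n (λ y → + d ℤ.* + ((2 + y) ^ n)) 0          ≡⟨ Δ^-scale n (+ d) (λ y → + ((2 + y) ^ n)) 0 ⟩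
    + d ℤ.* Δ^ n (λ y → + ((2 + y) ^ n)) 0          ≡⟨ cong (+ d ℤ.*_) (Δ^n-power n 0) ⟩
    + d ℤ.* + (n !)                                 ∎

-- Closure of integral multiples under scaling, subtraction and gcd

multiple-scale : ∀ n k d → IntPolyMultiple n d → IntPolyMultiple n (k * d)
multiple-scale n k d (P , ev) = + k ⊡ P , λ x 1≤x → trans (eval-⊡ (+ k) P (+ x))
  (trans (cong (+ k ℤ.*_) (ev x 1≤x)) (trans (sym (ℤₚ.pos-* k _)) (cong +_ (sym (*-assoc k d (powSum n x))))))

multiple-∸ : ∀ n d e f → f + e ≡ d → IntPolyMultiple n d → IntPolyMultiple n e → IntPolyMultiple n f
multiple-∸ n d e f f+e≡d (P , evP) (Q , evQ) = P ⊞ ℤ.-1ℤ ⊡ Q , λ x 1≤x → begin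
  evalℤ (P ⊞ ℤ.-1ℤ ⊡ Q) (+ x)
    ≡⟨ trans (eval-⊞ P (ℤ.-1ℤ ⊡ Q) (+ x)) (cong (λ z → evalℤ P (+ x) ℤ.+ z) (eval-⊡ ℤ.-1ℤ Q (+ x))) ⟩
  evalℤ P (+ x) ℤ.+ ℤ.-1ℤ ℤ.* evalℤ Q (+ x)
    ≡⟨ cong₂ (λ u v → u ℤ.+ ℤ.-1ℤ ℤ.* v)
         (trans (evP x 1≤x) (cong +_ (trans (cong (_* powSum n x) (sym f+e≡d)) (*-distribʳ-+ (powSum n x) f e)))) (evQ x 1≤x) ⟩
  (+ (f * powSum n x) ℤ.+ + (e * powSum n x)) ℤ.+ ℤ.-1ℤ ℤ.* + (e * powSum n x)
    ≡⟨ cancel (+ (f * powSum n x)) (+ (e * powSum n x)) ⟩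
  + (f * powSum n x) ∎
  where
  open ≡-Reasoning
  cancel : ∀ a b → (a ℤ.+ b) ℤ.+ ℤ.-1ℤ ℤ.* b ≡ a
  cancel = ℤ-Solver.solve-∀

multiple-combine : ∀ n x y a b g d → g + y * b ≡ x * a →
                   IntPolyMultiple n (a * d) → IntPolyMultiple n (b * d) → IntPolyMultiple n (g * d)
multiple-combine n x y a b g d eq a-mult b-mult = multiple-∸ n (x * (a * d)) (y * (b * d)) (g * d)
  (trans (cong (λ z → g * d + z) (sym (*-assoc y b d)))
    (trans (sym (*-distribʳ-+ d g (y * b))) (trans (cong (_* d) eq) (*-assoc x a d))))
  (multiple-scale n x (a * d) a-mult) (multiple-scale n y (b * d) b-mult)

multiple-gcd : ∀ n a b d → IntPolyMultiple n (a * d) → IntPolyMultiple n (b * d) → IntPolyMultiple n (gcd a b * d)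
multiple-gcd n a b d a-mult b-mult with Bézout.identity (gcd-GCD a b)
... | Bézout.+- x y eq = multiple-combine n x y a b (gcd a b) d eq a-mult b-mult
... | Bézout.-+ x y eq = multiple-combine n y x b a (gcd a b) d eq b-mult a-mult

-- Existence of primes and the exceptional prime 2

prime-divisor : ∀ n → 1 < n → Σ ℕ λ p → Prime p × p ∣ n
prime-divisor n@(suc _) 1<n with factorise n
... | record { factors = [] ; isFactorisation = eq } = ⊥-elim (<-irrefl (sym eq) 1<n)
... | record { factors = p ∷ ps ; isFactorisation = eq ; factorsPrime = p-prime ∷ _ } =
  p , p-prime , subst (p ∣_) (sym eq) (m∣m*n (product ps))

prime-above : ∀ n → Σ ℕ λ p → Prime p × n < p
prime-above n with prime-divisor (suc (n !)) (s<s (n!>0 n))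
  where
  n!>0 : ∀ n → 0 < n !
  n!>0 n = n≢0⇒n>0 (≢-nonZero⁻¹ (n !) {{n !≢0}})
... | p , p-prime , p∣ with p ≤? n
...   | no  p≰n = p , p-prime , ≰⇒> p≰n
...   | yes p≤n = ⊥-elim (p∤1 p-prime (∣m+n∣m⇒∣n (subst (p ∣_) (+-comm 1 (n !)) p∣) p∣n!))
  where
  p∣p! : ∀ p → .{{NonZero p}} → p ∣ p !
  p∣p! (suc p) = m∣m*n (p !)
  p∣n! : p ∣ n !
  p∣n! = ∣-trans (p∣p! p {{prime⇒nonZero p-prime}}) (m≤n⇒m!∣n! p≤n)

odd⇒1+2* : ∀ n → ¬ 2 ∣ n → n ≡ 1 + n / 2 * 2
odd⇒1+2* n 2∤n with n % 2 in eq | m≡m%n+[m/n]*n n 2 | m%n<n n 2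
... | zero        | n≡ | _              = ⊥-elim (2∤n (divides (n / 2) n≡))
... | suc zero    | n≡ | _              = n≡
... | suc (suc _) | _  | s≤s (s≤s ())

-- The last bit is 1 and the positive quotient has another. So `p = 2` with odd `m > 1`, the case
-- outside `remainder-LocPoly`, always satisfies `s_2(m) ≥ 2`.
1<n∧odd⇒2≤digitSum : ∀ n → 1 < n → ¬ 2 ∣ n → 2 ≤ digitSum 2 n
1<n∧odd⇒2≤digitSum n 1<n 2∤n = subst (2 ≤_) (sym (trans (cong (digitSum 2) (odd⇒1+2* n 2∤n)) (digitSum-digit (s<s z<s) 1 (n / 2) (s<s z<s))))
  (s≤s (digitSum-pos (s<s z<s) (n / 2) (m≥n⇒m/n>0 {n} {2} 1<n)))

eval-3-1 : ∀ P → Σ ℤ λ z → evalℤ P (+ 3) ≡ evalℤ P (+ 1) ℤ.+ + 2 ℤ.* z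
eval-3-1 []      = + 0 , refl
eval-3-1 (c ∷ P) with eval-3-1 P
... | z , eq = evalℤ P (+ 1) ℤ.+ + 3 ℤ.* z , trans (cong (λ u → c ℤ.+ + 3 ℤ.* u) eq) (expand c (evalℤ P (+ 1)) z)
  where
  expand : ∀ c u z → c ℤ.+ + 3 ℤ.* (u ℤ.+ + 2 ℤ.* z) ≡ c ℤ.+ + 1 ℤ.* u ℤ.+ + 2 ℤ.* (u ℤ.+ + 3 ℤ.* z)
  expand = ℤ-Solver.solve-∀

-- An integer polynomial takes values of equal parity at 1 and 3.
odd⇒¬LocPoly : ∀ i → 1 ≤ i → ¬ 2 ∣ suc i → ¬ LocPoly prime[2] 1 (λ x → suc i * powSum i x)
odd⇒¬LocPoly i@(suc i′) 1≤i 2∤1+i (locPoly N 2∤N P ev) with eval-3-1 P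
... | z , eq = p∤* prime[2] 2∤N (p∤* prime[2] 2∤1+i 2∤odd) (divides ∣ z ∣ (begin
  N * (suc i * (2 ^ i + 3 ^ i))     ≡⟨ cong ∣_∣ difference ⟩
  ∣ + 2 ℤ.* z ∣                     ≡⟨ ℤₚ.abs-* (+ 2) z ⟩
  2 * ∣ z ∣                         ≡⟨ *-comm 2 ∣ z ∣ ⟩
  ∣ z ∣ * 2                         ∎))
  where
  open ≡-Reasoning
  2∤3^ : ∀ e → ¬ 2 ∣ 3 ^ e
  2∤3^ zero    = p∤1 prime[2]
  2∤3^ (suc e) = p∤* prime[2] (λ 2∣3 → p∤1 prime[2] (∣m+n∣m⇒∣n {2} {2} {1} 2∣3 ∣-refl)) (2∤3^ e)
  2∤odd : ¬ 2 ∣ 2 ^ i + 3 ^ i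
  2∤odd 2∣ = 2∤3^ i (∣m+n∣m⇒∣n 2∣ (m∣m*n (2 ^ i′)))
  value : ∀ x → 1 ≤ x → evalℤ P (+ x) ≡ + (N * (suc i * powSum i x))
  value x 1≤x = trans (sym (ℤₚ.*-identityˡ _)) (ev x 1≤x)
  distribute : ∀ n m a b c → n * (m * (a + b + c)) ≡ n * (m * a) + n * (m * (b + c))
  distribute = solve-∀
  difference : + (N * (suc i * (2 ^ i + 3 ^ i))) ≡ + 2 ℤ.* z
  difference = ∙-cancelˡ ℤₚ.+-0-abelianGroup (+ (N * (suc i * powSum i 1))) _ _ (begin
    + (N * (suc i * powSum i 1) + N * (suc i * (2 ^ i + 3 ^ i)))
      ≡⟨ cong +_ (distribute N (suc i) (powSum i 1) (2 ^ i) (3 ^ i)) ⟨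
    + (N * (suc i * powSum i 3))
      ≡⟨ value 3 z<s ⟨
    evalℤ P (+ 3)
      ≡⟨ eq ⟩
    evalℤ P (+ 1) ℤ.+ + 2 ℤ.* z
      ≡⟨ cong (ℤ._+ (+ 2 ℤ.* z)) (value 1 z<s) ⟩
    + (N * (suc i * powSum i 1)) ℤ.+ + 2 ℤ.* z ∎)

⌊⌋≡true : ∀ {A : Set} (d : Dec A) → A → ⌊ d ⌋ ≡ true
⌊⌋≡true (yes _) _ = refl
⌊⌋≡true (no ¬a) a = ⊥-elim (¬a a)

-- The digit-sum criterion at one prime and the bound M_n

module _ {p : ℕ} (p-prime : Prime p) where

  private
    instance
      p-nonZero : NonZero p
      p-nonZero = prime⇒nonZero p-prime

    p≡1+pred : p ≡ suc (pred p)
    p≡1+pred = sym (suc-pred p)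

  digitSum<p⇒LocPoly : ∀ n → digitSum p (suc n) < p → LocPoly p-prime 1 (λ x → suc n * powSum n x)
  digitSum<p⇒LocPoly n s<p = p∣C*S⇒LocPoly p-prime n n≡0∨even (digitSum<p⇒p∣C*S p-prime p≡1+pred n s<p)
    where
    n≡0∨even : p ≡ 2 → n ≡ 0 ⊎ 2 ∣ suc n
    n≡0∨even refl with 2 ∣? suc n
    ... | yes 2∣1+n = inj₂ 2∣1+n
    ... | no  2∤1+n with n ≟ 0
    ...   | yes n≡0 = inj₁ n≡0
    ...   | no  n≢0 = ⊥-elim (<⇒≱ s<p (1<n∧odd⇒2≤digitSum (suc n) (s≤s (n≢0⇒n>0 n≢0)) 2∤1+n))

  digitSum≥p⇒¬LocPoly : ∀ n → p ≤ digitSum p (suc n) → ¬ LocPoly p-prime 1 (λ x → suc n * powSum n x)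
  digitSum≥p⇒¬LocPoly n s≥p F-poly with p ≟ 2 | 2 ∣? suc n | digitSum≥p⇒∃p∤C*S p-prime p≡1+pred n s≥p
  ... | no p≢2   | _         | j , j<1+n , p∤ = p∤ (LocPoly⇒p∣C*S p-prime n (λ p≡2 → ⊥-elim (p≢2 p≡2)) F-poly j j<1+n)
  ... | yes _    | yes 2∣1+n | j , j<1+n , p∤ = p∤ (LocPoly⇒p∣C*S p-prime n (λ _ → inj₂ 2∣1+n) F-poly j j<1+n)
  ... | yes refl | no 2∤1+n  | _ with n ≟ 0
  ...   | yes refl = <⇒≱ (s<s z<s) s≥p
  ...   | no  n≢0 with F-poly
  -- `LocPoly` is indexed by a primality proof; the same data are repackaged over `prime[2]`.
  ...     | locPoly N p∤N P ev = odd⇒¬LocPoly n (n≢0⇒n>0 n≢0) 2∤1+n (locPoly N p∤N P ev)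

  LocPoly⇒multiple : ∀ n a → LocPoly p-prime 1 (λ x → a * powSum n x) → Σ ℕ λ N → ¬ p ∣ N × IntPolyMultiple n (N * a)
  LocPoly⇒multiple n a (locPoly N p∤N P ev) = N , p∤N , P , λ x 1≤x →
    trans (sym (ℤₚ.*-identityˡ _)) (trans (ev x 1≤x) (cong +_ (sym (*-assoc N a (powSum n x)))))

  multiple⇒LocPoly : ∀ n a N → ¬ p ∣ N → IntPolyMultiple n (N * a) → LocPoly p-prime 1 (λ x → a * powSum n x)
  multiple⇒LocPoly n a N p∤N (P , ev) = locPoly N p∤N P λ x 1≤x →
    trans (ℤₚ.*-identityˡ _) (trans (ev x 1≤x) (cong +_ (*-assoc N a (powSum n x))))

  p[1+n]-multiple : ∀ n → Σ ℕ λ N → ¬ p ∣ N × IntPolyMultiple n (N * (p * suc n))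
  p[1+n]-multiple n = LocPoly⇒multiple n (p * suc n)
    (LocPoly-cong p-prime (λ x → sym (*-assoc p (suc n) (powSum n x))) (p[1+i]S-LocPoly p-prime n))

  private
    s : ℕ → ℕ
    s = digitSum p

    1<p′ : 1 < p
    1<p′ = 1<p p-prime

    quotient-cases : ∀ m b → m / p ≡ b → p ≤ s m → p ≤ m % p + s b × m ≡ m % p + b * p
    quotient-cases m b refl s≥p = subst (p ≤_) (digitSum-step 1<p′ m) s≥p , m≡m%n+[m/n]*n m p

    s0 : ∀ {a} → p ≤ a + s 0 → p ≤ a
    s0 {a} = subst (p ≤_) (trans (cong (λ z → a + z) (digitSum-0 p)) (+-identityʳ a))

  -- By the quotient `m / p`: 0 would make `s(m)` a single digit below `p`, 1 forces the last digit
  -- `p - 1`, and from 2 on already `m ≥ 2p`.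
  digitSum≥p⇒2p≤1+m : ∀ m → p ≤ digitSum p m → 2 * p ≤ suc m
  digitSum≥p⇒2p≤1+m m s≥p with m / p in eq
  ... | zero with quotient-cases m 0 eq s≥p
  ...   | p≤ , _ = ⊥-elim (<⇒≱ (m%n<n m p) (s0 p≤))
  digitSum≥p⇒2p≤1+m m s≥p | suc zero with quotient-cases m 1 eq s≥p
  ...   | p≤ , m≡ = subst (2 * p ≤_) (sym (trans (cong suc m≡) (rearrange (m % p) p)))
                     (+-monoˡ-≤ (1 * p) (≤-trans p≤ (+-monoʳ-≤ (m % p) (digitSum≤ 1<p′ 1))))
    where
    rearrange : ∀ a p → suc (a + 1 * p) ≡ a + 1 + 1 * p
    rearrange = solve-∀
  digitSum≥p⇒2p≤1+m m s≥p | suc (suc b) with quotient-cases m (suc (suc b)) eq s≥p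
  ...   | _ , m≡ = ≤-trans (*-monoˡ-≤ p {2} {2 + b} (s≤s (s≤s z≤n)))
                     (≤-trans (subst ((2 + b) * p ≤_) (sym m≡) (m≤n+m _ (m % p))) (n≤1+n m))

  -- Quotient 1 would force the odd number `m = 2p - 1`. For quotient 2 the last digit is `p - 1`,
  -- giving `m + 1 = 3p`, or `p - 2`, giving `m + 2 = 3p`; the latter makes `p` even, hence 2.
  digitSum≥p⇒3p≤1+m : ∀ m → 2 ∣ m → p ≤ digitSum p m → 3 * p ≤ suc m
  digitSum≥p⇒3p≤1+m m 2∣m s≥p with m / p in eq
  ... | zero with quotient-cases m 0 eq s≥p
  ...   | p≤ , _ = ⊥-elim (<⇒≱ (m%n<n m p) (s0 p≤))
  digitSum≥p⇒3p≤1+m m 2∣m s≥p | suc zero with quotient-cases m 1 eq s≥p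
  ...   | p≤ , m≡ = ⊥-elim (p∤1 prime[2] (∣m+n∣m⇒∣n (subst (2 ∣_) (+-comm 1 m) (subst (2 ∣_) (sym 1+m≡2p) (m∣m*n p))) 2∣m))
    where
    rearrange : ∀ a p → suc (a + 1 * p) ≡ suc a + 1 * p
    rearrange = solve-∀
    1+a≡p : suc (m % p) ≡ p
    1+a≡p = ≤-antisym (m%n<n m p) (≤-trans p≤ (≤-trans (+-monoʳ-≤ (m % p) (digitSum≤ 1<p′ 1)) (≤-reflexive (+-comm (m % p) 1))))
    1+m≡2p : suc m ≡ 2 * p
    1+m≡2p = trans (cong suc m≡) (trans (rearrange (m % p) p) (cong (_+ 1 * p) 1+a≡p))
  digitSum≥p⇒3p≤1+m m 2∣m s≥p | suc (suc zero) with quotient-cases m 2 eq s≥p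
  ...   | p≤ , m≡ with m≤n⇒m<n∨m≡n (m%n<n m p)
  ...     | inj₂ 1+a≡p = ≤-reflexive (trans (cong (_+ 2 * p) (sym 1+a≡p)) (sym (cong suc m≡)))
  ...     | inj₁ 1+a<p = ⊥-elim absurd
    where
    2+a≡p : 2 + m % p ≡ p
    2+a≡p = ≤-antisym 1+a<p (≤-trans p≤ (≤-trans (+-monoʳ-≤ (m % p) (digitSum≤ 1<p′ 2)) (≤-reflexive (+-comm (m % p) 2))))
    2+m≡3p : 2 + m ≡ 3 * p
    2+m≡3p = trans (cong (λ z → 2 + z) m≡) (cong (_+ 2 * p) 2+a≡p)
    2∣p : 2 ∣ p
    2∣p with euclidsLemma 3 p prime[2] (subst (2 ∣_) 2+m≡3p (∣m∣n⇒∣m+n ∣-refl 2∣m))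
    ... | inj₁ 2∣3 = ⊥-elim (p∤1 prime[2] (∣m+n∣m⇒∣n {2} {2} {1} 2∣3 ∣-refl))
    ... | inj₂ 2∣p = 2∣p
    -- In base 2 the quotient 2 = 10₂ has digit sum 1, too small for s_p(m) ≥ p.
    p≢2 : ∀ {a} → p ≡ 2 → 2 + a ≡ p → ¬ p ≤ a + s 2
    p≢2 refl refl (s≤s ())
    absurd : ⊥
    absurd with prime⇒irreducible p-prime 2∣p
    ... | inj₁ ()
    ... | inj₂ 2≡p = p≢2 (sym 2≡p) 2+a≡p p≤
  digitSum≥p⇒3p≤1+m m 2∣m s≥p | suc (suc (suc b)) with quotient-cases m (3 + b) eq s≥p
  ...   | _ , m≡ = ≤-trans (*-monoˡ-≤ p {3} {3 + b} (s≤s (s≤s (s≤s z≤n))))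
                     (≤-trans (subst ((3 + b) * p ≤_) (sym m≡) (m≤n+m _ (m % p))) (n≤1+n m))

  digitSum≥p⇒belowM : ∀ n → p ≤ digitSum p (suc n) → belowM n p ≡ true
  digitSum≥p⇒belowM n s≥p with n % 2 in eq | m≡m%n+[m/n]*n n 2 | m%n<n n 2
  ... | zero        | _  | _ = ⌊⌋≡true (2 * p ≤? n + 2) (subst (2 * p ≤_) (+-comm 2 n) (digitSum≥p⇒2p≤1+m (suc n) s≥p))
  ... | suc zero    | n≡ | _ = ⌊⌋≡true (3 * p ≤? n + 2) (subst (3 * p ≤_) (+-comm 2 n)
                                 (digitSum≥p⇒3p≤1+m (suc n) (divides (suc (n / 2)) (cong suc n≡)) s≥p))
  ... | suc (suc _) | _  | s≤s (s≤s ())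

  digitSum≥p⇒factor≡p : ∀ n → p ≤ digitSum p (suc n) → factor n p ≡ p
  digitSum≥p⇒factor≡p n s≥p = if-true (⌊⌋≡true (prime? p) p-prime) (digitSum≥p⇒belowM n s≥p) (⌊⌋≡true (p ≤? digitSum p (suc n)) s≥p)
    where
    if-true : ∀ {a b c : Bool} → a ≡ true → b ≡ true → c ≡ true → (if a ∧ b ∧ c then p else 1) ≡ p
    if-true refl refl refl = refl

  digitSum≥p⇒p∣qFormula : ∀ n → p ≤ digitSum p (suc n) → p ∣ qFormula n
  digitSum≥p⇒p∣qFormula n s≥p = ∈⇒∣product (subst (_∈ map (factor n) (upTo (n + 3))) (digitSum≥p⇒factor≡p n s≥p)
    (∈-map⁺ (factor n) (∈-upTo⁺ p<n+3)))
    where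
    p<n+3 : p < n + 3
    p<n+3 = subst (suc p ≤_) (+-comm 3 n) (s≤s (≤-trans (m≤n*m p 2) (digitSum≥p⇒2p≤1+m (suc n) s≥p)))

-- From the local criteria to the product formula

factor-cases : ∀ n p → factor n p ≡ 1 ⊎ (Prime p × p ≤ digitSum p (suc n) × factor n p ≡ p)
factor-cases n p = cases (prime? p) (belowM n p) (p ≤? digitSum p (suc n))
  where
  cases : ∀ {A B : Set} (a : Dec A) (b : Bool) (c : Dec B) →
          (if ⌊ a ⌋ ∧ b ∧ ⌊ c ⌋ then p else 1) ≡ 1 ⊎ (A × B × (if ⌊ a ⌋ ∧ b ∧ ⌊ c ⌋ then p else 1) ≡ p)
  cases (no _)  _     _       = inj₁ refl
  cases (yes _) false _       = inj₁ refl
  cases (yes _) true  (no _)  = inj₁ refl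
  cases (yes a) true  (yes c) = inj₂ (a , c , refl)

distinct-primes-coprime : ∀ {p q} → Prime p → Prime q → ¬ p ≡ q → Coprime p q
distinct-primes-coprime p-prime q-prime p≢q (d∣p , d∣q)
  with prime⇒irreducible p-prime d∣p | prime⇒irreducible q-prime d∣q
... | inj₁ d≡1  | _         = d≡1
... | inj₂ _    | inj₁ d≡1  = d≡1
... | inj₂ refl | inj₂ refl = ⊥-elim (p≢q refl)

factors-coprime : ∀ n {p q} → p < q → Coprime (factor n p) (factor n q)
factors-coprime n {p} {q} p<q with factor-cases n p | factor-cases n q
... | inj₁ eq | _ = subst (λ z → Coprime z (factor n q)) (sym eq) (Coprimality.1-coprimeTo (factor n q))
... | inj₂ _  | inj₁ eq = subst (Coprime (factor n p)) (sym eq) (Coprimality.sym (Coprimality.1-coprimeTo (factor n p)))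
... | inj₂ (p-prime , _ , eq) | inj₂ (q-prime , _ , eq′) =
  subst₂ Coprime (sym eq) (sym eq′) (distinct-primes-coprime p-prime q-prime (<⇒≢ p<q))

product∣ : ∀ {m} ns → AllPairs Coprime ns → All (_∣ m) ns → product ns ∣ m
product∣ []       _                  _               = 1∣ _
product∣ (n ∷ ns) (n-coprime ∷ ps) (divides k refl ∷ ns∣m) = subst (n * product ns ∣_) (*-comm n k)
  (*-monoʳ-∣ n (Coprimality.coprime-divisor (Coprimality.sym (coprime-product ns n-coprime))
    (subst (product ns ∣_) (*-comm k n) (product∣ ns ps ns∣m))))
  where
  coprime-product : ∀ ns → All (Coprime n) ns → Coprime n (product ns)
  coprime-product []       []       = Coprimality.sym (Coprimality.1-coprimeTo n)
  coprime-product (m ∷ ns) (c ∷ cs) {d} (d∣n , d∣mn) = coprime-product ns cs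
    (d∣n , Coprimality.coprime-divisor (λ (e∣d , e∣m) → c (∣-trans e∣d d∣n , e∣m)) d∣mn)

-- A prime `p` of the product that missed `d` would let `d` serve as the multiplier `N`, making
-- `(n+1) S_n` p-integral. The factors are pairwise coprime, so their product divides too.
qFormula∣ : ∀ n d → IntPolyMultiple n (d * suc n) → qFormula n ∣ d
qFormula∣ n d mult = subst (λ ns → product ns ∣ d) (sym (map-upTo (factor n) (n + 3)))
  (product∣ _ (AllPairs.applyUpTo⁺₁ (factor n) (n + 3) (λ i<j _ → factors-coprime n i<j))
              (All.applyUpTo⁺₂ (factor n) (n + 3) factor∣))
  where
  factor∣ : ∀ p → factor n p ∣ d
  factor∣ p with factor-cases n p
  ... | inj₁ eq = subst (_∣ d) (sym eq) (1∣ d)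
  ... | inj₂ (p-prime , s≥p , eq) with p ∣? d
  ...   | yes p∣d = subst (_∣ d) (sym eq) p∣d
  ...   | no  p∤d = ⊥-elim (digitSum≥p⇒¬LocPoly p-prime n s≥p (multiple⇒LocPoly p-prime n (suc n) d p∤d mult))

-- Starting point of `descent`. The prime 2 is an arbitrary choice, and `N` is positive because it
-- is not divisible by 2.
positive-multiple : ∀ n → Σ ℕ λ e → 1 ≤ e × IntPolyMultiple n (e * suc n)
positive-multiple n = clear prime[2] (p[1+n]-multiple prime[2] n)
  where
  clear : ∀ {p} → Prime p → (Σ ℕ λ N → ¬ p ∣ N × IntPolyMultiple n (N * (p * suc n))) →
          Σ ℕ λ e → 1 ≤ e × IntPolyMultiple n (e * suc n)
  clear {p} p-prime (zero    , p∤N , mult) = ⊥-elim (p∤N (p ∣0))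
  clear {p} p-prime (N@(suc _) , p∤N , mult) = N * p , *-mono-≤ {1} {N} {1} {p} z<s (<⇒≤ (1<p p-prime)) ,
    subst (IntPolyMultiple n) (sym (*-assoc N p (suc n))) mult

-- If `s_p(n+1) < p`, then `(n+1) S_n` is p-integral already; otherwise `q` brings the single factor
-- `p` that suffices.
multiple-away-from-p : ∀ {p} → Prime p → ∀ n q → (p ≤ digitSum p (suc n) → p ∣ q) →
                       Σ ℕ λ N → ¬ p ∣ N × IntPolyMultiple n (N * (suc n * q))
multiple-away-from-p {p} p-prime n q p∣q = cases (p ≤? digitSum p (suc n))
  where
  rearrange : ∀ q a b → q * (a * b) ≡ a * (b * q)
  rearrange = solve-∀
  rearrange′ : ∀ k a p b → k * (a * (p * b)) ≡ a * (b * (k * p))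
  rearrange′ = solve-∀
  cases : Dec (p ≤ digitSum p (suc n)) → Σ ℕ λ N → ¬ p ∣ N × IntPolyMultiple n (N * (suc n * q))
  cases (no s≱p) =
    let N , p∤N , mult = LocPoly⇒multiple p-prime n (suc n) (digitSum<p⇒LocPoly p-prime n (≰⇒> s≱p))
    in N , p∤N , subst (IntPolyMultiple n) (rearrange q N (suc n)) (multiple-scale n q (N * suc n) mult)
  cases (yes s≥p) =
    let divides k q≡kp   = p∣q s≥p
        N , p∤N , mult   = p[1+n]-multiple p-prime n
    in N , p∤N , subst (IntPolyMultiple n)
         (trans (rearrange′ k N p (suc n)) (cong (λ q → N * (suc n * q)) (sym q≡kp)))
         (multiple-scale n k (N * (p * suc n)) mult)

-- The multipliers e with e · d · (1^n + ⋯ + x^n) integral are closed under gcd, and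
-- for each prime some multiplier avoids it.
descent : ∀ n d → (∀ {p} → Prime p → Σ ℕ λ N → ¬ p ∣ N × IntPolyMultiple n (N * d)) →
          ∀ e → 1 ≤ e → IntPolyMultiple n (e * d) → IntPolyMultiple n d
descent n d away = <-rec _ step
  where
  step : ∀ e → (∀ {f} → f < e → 1 ≤ f → IntPolyMultiple n (f * d) → IntPolyMultiple n d) →
         1 ≤ e → IntPolyMultiple n (e * d) → IntPolyMultiple n d
  step (suc zero)      rec 1≤e mult = subst (IntPolyMultiple n) (*-identityˡ d) mult
  step e@(suc (suc _)) rec 1≤e mult with prime-divisor e (s<s z<s)
  ... | p , p-prime , p∣e with away p-prime
  ...   | N , p∤N , N-mult = rec g<e g≥1 (multiple-gcd n e N d mult N-mult)
    where
    g≥1 : 1 ≤ gcd e N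
    g≥1 = n≢0⇒n>0 λ g≡0 → 1+n≢0 (gcd[m,n]≡0⇒m≡0 {e} {N} g≡0)
    g<e : gcd e N < e
    g<e = ≤∧≢⇒< (∣⇒≤ (gcd[m,n]∣m e N)) λ g≡e → p∤N (∣-trans p∣e (subst (_∣ N) g≡e (gcd[m,n]∣n e N)))

[1+n]*qFormula-multiple : ∀ n → IntPolyMultiple n (suc n * qFormula n)
[1+n]*qFormula-multiple n = from (qFormula n) (λ p-prime → digitSum≥p⇒p∣qFormula p-prime n) (positive-multiple n)
  where
  rearrange : ∀ q a b → q * (a * b) ≡ a * (b * q)
  rearrange = solve-∀
  from : ∀ q → (∀ {p} → Prime p → p ≤ digitSum p (suc n) → p ∣ q) →
         (Σ ℕ λ e → 1 ≤ e × IntPolyMultiple n (e * suc n)) → IntPolyMultiple n (suc n * q)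
  from q p∣q (e , 1≤e , mult) = descent n (suc n * q) (λ p-prime → multiple-away-from-p p-prime n q (p∣q p-prime)) e 1≤e
    (subst (IntPolyMultiple n) (rearrange q e (suc n)) (multiple-scale n q (e * suc n) mult))

-- Minimality joins two divisibilities: any admissible `d` is `e * suc n` by finite differences, and
-- then `qFormula n` divides `e`.
qFormula-IsQ : ∀ n → IsQ n (qFormula n)
qFormula-IsQ n = isQ (qFormula n) (qFormula∣ n) ([1+n]*qFormula-multiple n) (positive-multiple n)
  where
  isQ : ∀ q → (∀ e → IntPolyMultiple n (e * suc n) → q ∣ e) → IntPolyMultiple n (suc n * q) →
        (Σ ℕ λ e → 1 ≤ e × IntPolyMultiple n (e * suc n)) → IsQ n q
  isQ q q∣ q-mult (e , 1≤e , mult) = positive (q∣ e mult) , q-mult , minimal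
    where
    positive : ∀ {q} → q ∣ e → 1 ≤ suc n * q
    positive {zero}  0∣e = ⊥-elim (<⇒≢ 1≤e (sym (0∣⇒≡0 0∣e)))
    positive {suc _} _   = z<s
    minimal : ∀ d → 1 ≤ d → IntPolyMultiple n d → suc n * q ≤ d
    minimal d 1≤d d-mult with 1+n∣multiple n d d-mult
    ... | divides e refl = ∣⇒≤ {{>-nonZero 1≤d}} (subst (suc n * q ∣_) (*-comm (suc n) e) (*-monoʳ-∣ (suc n) (q∣ e d-mult)))

-- Sharpness of the bound and unboundedness

-- Take `n = 2p - 2`: then `n + 1 = (p-1) + p` has digit sum exactly `p`. In the proof `p = r + 2`.
sharp-even : ∀ N → Σ ℕ λ n → N ≤ n × Σ ℕ λ k → n ≡ 2 * k ×
             Σ ℕ λ p → Prime p × 2 * p ≡ n + 2 × Σ ℕ λ q → IsQ n q × p ∣ q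
sharp-even N with prime-above (2 + N)
... | p@(suc (suc r)) , p-prime , s≤s (s≤s N<r) = 2 * suc r , ≤-trans (<⇒≤ N<r) (≤-trans (n≤1+n r) (m≤n*m (suc r) 2)) , suc r , refl ,
  p , p-prime , 2p≡ r , qFormula (2 * suc r) , qFormula-IsQ (2 * suc r) ,
  digitSum≥p⇒p∣qFormula p-prime (2 * suc r) (≤-reflexive (sym s≡p))
  where
  2p≡ : ∀ r → 2 * suc (suc r) ≡ 2 * suc r + 2
  2p≡ = solve-∀
  digits : ∀ r → suc (2 * suc r) ≡ suc r + 1 * suc (suc r)
  digits = solve-∀
  s≡p : digitSum p (suc (2 * suc r)) ≡ p
  s≡p = trans (cong (digitSum p) (digits r)) (trans (digitSum-digit (s<s z<s) (suc r) 1 (n<1+n (suc r)))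
    (trans (cong (λ z → suc r + z) (digitSum-small {p} (s<s z<s) 1 (s<s z<s))) (+-comm (suc r) 1)))

-- Take `n = 3p - 2`: then `n + 1 = (p-1) + 2p` has digit sum `p + 1`, where `p > 2` makes 2 a digit
-- and `n` odd. With `p = 2h + 1` this is `n = 6h + 1`.
sharp-odd : ∀ N → Σ ℕ λ n → N ≤ n × Σ ℕ λ k → n ≡ 2 * k + 1 ×
            Σ ℕ λ p → Prime p × 3 * p ≡ n + 2 × Σ ℕ λ q → IsQ n q × p ∣ q
sharp-odd N with prime-above (2 + N)
... | p , p-prime , 2+N<p = 2 * (3 * h) + 1 , N≤n , 3 * h , refl , p , p-prime , 3p≡ ,
  qFormula n , qFormula-IsQ n , digitSum≥p⇒p∣qFormula p-prime n (subst (p ≤_) (sym s≡) (≤-trans (≤-reflexive p≡) (n≤1+n _)))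
  where
  instance
    p-nonZero : NonZero p
    p-nonZero = prime⇒nonZero p-prime
  h = p / 2
  n = 2 * (3 * h) + 1
  2<p : 2 < p
  2<p = ≤-<-trans (m≤m+n 2 N) 2+N<p
  2∤p : ¬ 2 ∣ p
  2∤p 2∣p with prime⇒irreducible p-prime 2∣p
  ... | inj₁ ()
  ... | inj₂ 2≡p = <-irrefl 2≡p 2<p
  p≡ : p ≡ 1 + h * 2
  p≡ = odd⇒1+2* p 2∤p
  N≤n : N ≤ n
  N≤n = ≤-trans (m≤n+m N 2) (≤-trans (<⇒≤ 2+N<p) (≤-trans (≤-reflexive p≡)
    (subst (1 + h * 2 ≤_) (expand h) (m≤m+n (1 + h * 2) (4 * h)))))
    where
    expand : ∀ h → 1 + h * 2 + 4 * h ≡ 2 * (3 * h) + 1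
    expand = solve-∀
  3p≡ : 3 * p ≡ n + 2
  3p≡ = trans (cong (3 *_) p≡) (expand h)
    where
    expand : ∀ h → 3 * (1 + h * 2) ≡ 2 * (3 * h) + 1 + 2
    expand = solve-∀
  s≡ : digitSum p (suc n) ≡ suc (1 + h * 2)
  s≡ = trans (cong (digitSum p) (trans (digits h) (cong (λ z → h * 2 + 2 * z) (sym p≡))))
    (trans (digitSum-digit (<⇒≤ 2<p) (h * 2) 2 (subst (h * 2 <_) (sym p≡) (n<1+n _)))
      (trans (cong (λ z → h * 2 + z) (digitSum-small (<⇒≤ 2<p) 2 2<p)) (+-comm (h * 2) 2)))
    where
    digits : ∀ h → suc (2 * (3 * h) + 1) ≡ h * 2 + 2 * (1 + h * 2)
    digits = solve-∀

IsQ⇒nonZero : ∀ n q → IsQ n q → NonZero q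
IsQ⇒nonZero n zero    (1≤ , _) = ⊥-elim (<⇒≢ 1≤ (sym (*-zeroʳ n)))
IsQ⇒nonZero n (suc _) _        = _

-- From `2p = n + 2 > 2B` the prime `p` exceeds `B`, and it divides the nonzero `q`.
unbounded : ∀ B → Σ ℕ λ n → Σ ℕ λ q → IsQ n q × B < q
unbounded B with sharp-even (2 * B)
... | n , 2B≤n , _ , _ , p , _ , 2p≡n+2 , q , isQ , p∣q = n , q , isQ , <-≤-trans B<p (∣⇒≤ {{IsQ⇒nonZero n q isQ}} p∣q)
  where
  B<p : B < p
  B<p = *-cancelˡ-< 2 B p (subst (2 * B <_) (sym 2p≡n+2) (≤-<-trans 2B≤n (m<m+n n z<s)))

theorem2 : (∀ (n : ℕ) → Σ ℕ λ q → IsQ n q × q ≡ qFormula n)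
    × (∀ (N : ℕ) → Σ ℕ λ n → N ≤ n × Σ ℕ λ k → n ≡ 2 * k ×
    Σ ℕ λ p → Prime p × 2 * p ≡ n + 2 × Σ ℕ λ q → IsQ n q × p ∣ q)
    × (∀ (N : ℕ) → Σ ℕ λ n → N ≤ n × Σ ℕ λ k → n ≡ 2 * k + 1 ×
    Σ ℕ λ p → Prime p × 3 * p ≡ n + 2 × Σ ℕ λ q → IsQ n q × p ∣ q)
    × (∀ (B : ℕ) → Σ ℕ λ n → Σ ℕ λ q → IsQ n q × B < q)
theorem2 = (λ n → qFormula n , qFormula-IsQ n , refl) , sharp-even , sharp-odd , unbounded
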